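{- There is a randomized algorithm for Hostile-Constrained Correlation Clustering which, given any instance $G=(V,E^+,E^-,\emptyset,H)$ with $n=|V|$ nodes, runs in $O(n^3)$ time and returns a feasible clustering whose expected cost is at most $3$ times the minimum cost of a feasible clustering of $G$.
   Context: An instance $G=(V,E^+,E^-,\emptyset,H)$ has a finite node set $V$; every unordered pair of distinct nodes $uv=vu$ is in exactly one of $E^+$ (positive edges) and $E^-$ (negative edges); $H$ is a set of (hostile) unordered pairs of distinct nodes; there are no friendly pairs. For a clustering (partition) $\mathcal{C}$ of $V$, with $\mathcal{C}(u)$ the cluster of $u$, $\mathrm{cost}_G(\mathcal{C})=|\{uv\in E^+:\mathcal{C}(u)\ne\mathcal{C}(v)\}|+|\{uv\in E^-:\mathcal{C}(u)=\mathcal{C}(v)\}|$. $\mathcal{C}$ is feasible if $\mathcal{C}(u)\ne\mathcal{C}(v)$ for all $uv\in H$. -}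

module Defs where

open import Data.Bool using (Bool; true; false; T; not; _∧_; if_then_else_)
open import Data.Fin using (Fin; toℕ; fromℕ<; remQuot)
import Data.Fin as Fin
open import Data.Integer using (+_)
open import Data.List using (List; []; _∷_; _++_; length; filterᵇ; allFin; cartesianProduct)
open import Data.Nat using (ℕ; zero; suc; _+_; _*_; _∸_; _^_; _%_; _≤_; _<?_; _≡ᵇ_; _<ᵇ_)
open import Data.Nat.Properties using (m^n≢0)
open import Data.Product using (_×_; _,_; proj₁; proj₂; ∃-syntax; uncurry)
open import Data.Rational using (ℚ) renaming (_*_ to _*ℚ_; _/_ to _/ℚ_)
open import Data.Rational.Properties using () renaming (+-0-commutativeMonoid to ℚ-+-commutativeMonoid)
open import Algebra.Properties.CommutativeMonoid.Sum ℚ-+-commutativeMonoid using (sum)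
open import Relation.Binary.PropositionalEquality using (_≡_; _≢_)
open import Relation.Nullary using (yes; no; does)

------------------------------------------------------------------------
-- Hostile-constrained correlation clustering

-- The node set is Fin n. Sets of unordered pairs of distinct nodes are
-- symmetric, irreflexive Boolean matrices.
record Instance (n : ℕ) : Set where
  field
    E⁺        : Fin n → Fin n → Bool
    H         : Fin n → Fin n → Bool
    E⁺-sym    : ∀ u v → E⁺ u v ≡ E⁺ v u
    E⁺-irrefl : ∀ u → E⁺ u u ≡ false
    H-sym     : ∀ u v → H u v ≡ H v u
    H-irrefl  : ∀ u → H u u ≡ false

  -- Every pair of distinct nodes is in exactly one of E⁺ and E⁻.
  E⁻ : Fin n → Fin n → Bool
  E⁻ u v = not (does (u Fin.≟ v)) ∧ not (E⁺ u v)

-- A partition of the nodes, given by the name C u of the cluster of each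
-- node u. Only equality of names matters.
Clustering : ℕ → Set
Clustering n = Fin n → ℕ

-- Each unordered pair of distinct nodes occurs once, as (u , v) with u < v.
pairs : ∀ n → List (Fin n × Fin n)
pairs n = filterᵇ (λ (u , v) → toℕ u <ᵇ toℕ v) (cartesianProduct (allFin n) (allFin n))

cost : ∀ {n} → Instance n → Clustering n → ℕ
cost {n} G C =
    length (filterᵇ (λ (u , v) → E⁺ u v ∧ not (C u ≡ᵇ C v)) (pairs n))
  + length (filterᵇ (λ (u , v) → E⁻ u v ∧ (C u ≡ᵇ C v)) (pairs n))
  where open Instance G

Feasible : ∀ {n} → Instance n → Clustering n → Set
Feasible G C = ∀ u v → T (Instance.H G u v) → C u ≢ C v

IsMinimumCost : ∀ {n} → Instance n → ℕ → Set
IsMinimumCost G m =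
    (∃[ C ] (Feasible G C × cost G C ≡ m))
  × (∀ C → Feasible G C → m ≤ cost G C)

------------------------------------------------------------------------
-- Finite probability

-- draw k f draws i uniformly from {0, …, k} and continues as f i.
data Dist (A : Set) : Set where
  ret  : A → Dist A
  draw : (k : ℕ) → (Fin (suc k) → Dist A) → Dist A

_>>=_ : ∀ {A B} → Dist A → (A → Dist B) → Dist B
ret a    >>= g = g a
draw k f >>= g = draw k (λ i → f i >>= g)

-- P holds at every outcome (every outcome has positive probability).
Always : ∀ {A} → (A → Set) → Dist A → Set
Always P (ret a)    = P a
Always P (draw k f) = ∀ i → Always P (f i)

expectation : ∀ {A} → (A → ℚ) → Dist A → ℚ
expectation X (ret a)    = X a
expectation X (draw k f) = (+ 1 /ℚ suc k) *ℚ sum (λ i → expectation X (f i))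

fromℕ : ℕ → ℚ
fromℕ k = + k /ℚ 1

------------------------------------------------------------------------
-- Randomized word-RAM programs, in structured form

-- A program has scalar variables and arrays, both named by numbers. Arrays
-- are random-access, with no a-priori length.

data Op : Set where
  add sub mul less equal : Op

data Expr : Set where
  lit  : ℕ → Expr
  var  : ℕ → Expr
  read : (array : ℕ) (index : Expr) → Expr
  op   : Op → Expr → Expr → Expr

data Command : Set where
  assign       : (x : ℕ) → Expr → Command
  write        : (array : ℕ) (index value : Expr) → Command
  -- Set x to a uniformly random element of {0, …, e - 1} (to 0 when e is 0).
  assignRandom : (x : ℕ) → (e : Expr) → Command
  ifte         : Expr → (thenBranch elseBranch : List Command) → Command
  while        : Expr → List Command → Command

Program : Set
Program = List Command

record State : Set where
  constructor state
  field
    vars   : ℕ → ℕ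
    arrays : ℕ → ℕ → ℕ

open State public

_[_↦_] : {A : Set} → (ℕ → A) → ℕ → A → (ℕ → A)
(f [ x ↦ a ]) y = if y ≡ᵇ x then a else f y

setVar : ℕ → ℕ → State → State
setVar x a s = state (vars s [ x ↦ a ]) (arrays s)

setCell : ℕ → ℕ → ℕ → State → State
setCell r i a s = state (vars s) (arrays s [ r ↦ arrays s r [ i ↦ a ] ])

-- Reduction to a machine word of w bits.
word : ℕ → ℕ → ℕ
word w a = _%_ a (2 ^ w) {{m^n≢0 2 w}}

bit : Bool → ℕ
bit true  = 1
bit false = 0

⟦_⟧op : Op → ℕ → ℕ → ℕ
⟦ add   ⟧op a b = a + b
⟦ sub   ⟧op a b = a ∸ b
⟦ mul   ⟧op a b = a * b
⟦ less  ⟧op a b = bit (a <ᵇ b)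
⟦ equal ⟧op a b = bit (a ≡ᵇ b)

eval : (w : ℕ) → State → Expr → ℕ
eval w s (lit a)      = word w a
eval w s (var x)      = vars s x
eval w s (read r e)   = arrays s r (eval w s e)
eval w s (op o e₁ e₂) = word w (⟦ o ⟧op (eval w s e₁) (eval w s e₂))

-- The commands still to be executed, and the current state.
Config : Set
Config = List Command × State

Halted : Config → Set
Halted κ = proj₁ κ ≡ []

-- One unit of time. It covers the evaluation of the expressions heading a
-- single command: these are part of the program, so their sizes are bounded by
-- a constant independent of the input, and each operator acts on w-bit words.
step : (w : ℕ) → Config → Dist Config
step w ([] , s)                     = ret ([] , s)
step w (assign x e ∷ ks , s)        = ret (ks , setVar x (eval w s e) s)
step w (write r e₁ e₂ ∷ ks , s)     = ret (ks , setCell r (eval w s e₁) (eval w s e₂) s)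
step w (assignRandom x e ∷ ks , s) with eval w s e
... | zero  = ret (ks , setVar x 0 s)
... | suc k = draw k (λ i → ret (ks , setVar x (toℕ i) s))
step w (ifte e ps qs ∷ ks , s) with eval w s e
... | zero  = ret (qs ++ ks , s)
... | suc _ = ret (ps ++ ks , s)
step w (while e ps ∷ ks , s) with eval w s e
... | zero  = ret (ks , s)
... | suc _ = ret (ps ++ while e ps ∷ ks , s)

run : (w : ℕ) → (time : ℕ) → Config → Dist Config
run w zero    κ = ret κ
run w (suc t) κ = step w κ >>= run w t

-- Row-major layout: entry (i , j) is at index n * i + j.
flatten : ∀ {n} → (Fin n → Fin n → Bool) → (ℕ → ℕ)
flatten {n} M k with k <? n * n
... | yes k<n² = bit (uncurry M (remQuot n (fromℕ< k<n²)))
... | no  _    = 0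

-- Variable 0 holds n, arrays 0 and 1 hold the matrices of E⁺ and H, and
-- everything else is 0.
input : ∀ {n} → Instance n → State
input {n} G = state
  ((λ _ → 0) [ 0 ↦ n ])
  (((λ _ _ → 0) [ 0 ↦ flatten E⁺ ]) [ 1 ↦ flatten H ])
  where open Instance G

-- The name of the cluster of u is left in cell u of array 2.
output : ∀ {n} → Config → Clustering n
output κ u = arrays (proj₂ κ) 2 (toℕ u)

------------------------------------------------------------------------
-- Asymptotics

_∈O_ : (ℕ → ℕ) → (ℕ → ℕ) → Set
f ∈O g = ∃[ c ] ∃[ n₀ ] (∀ n → n₀ ≤ n → f n ≤ c * g n)

{-# OPTIONS --safe #-}
module Submission where

-- First turn pairs negative until no two positive neighbours of a node are hostile: hostile pairs
-- count as negative from the start, and whenever uv and uw are positive while vw is hostile, both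
-- uv and uw become negative. Then run the random pivot algorithm on the resulting signs; its
-- clusters consist of positive neighbours of the pivot, so they are feasible.
--
-- A feasible clustering cuts uv or uw in each conflict, so among the pairs turned negative it keeps
-- at most as many together as it cuts (Budget). For the new signs, let X and Y indicate the
-- mistakes made by the pivot algorithm and by a fixed feasible clustering. The mistakes settled in
-- one round are the sides opposite to the pivot of the triangles with exactly two positive sides;
-- every clustering makes a mistake on such a triangle, and summing over all pivots charges each of
-- its sides equally, so E[Σ X] ≤ E[Σ 3XY] by induction over the rounds. Comparing the original cost
-- with X and Y pair by pair then loses nothing: the discrepancy on the pairs turned negative is
-- covered by the budget.

open import Defs
open import Data.Bool using (Bool; true; false; T; not; _∧_; _∨_; _xor_; if_then_else_)
open import Data.Bool.Properties using (T-≡; ∧-comm; ∧-identityʳ; ∧-zeroʳ)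
open import Data.Empty using (⊥; ⊥-elim)
open import Data.Fin using (Fin; zero; suc; toℕ; fromℕ<; combine; remQuot)
import Data.Fin as Fin
open import Data.Fin.Properties using (toℕ-injective; toℕ<n; toℕ-fromℕ<; fromℕ<-toℕ; toℕ-combine; remQuot-combine; combine-injective)
open import Data.Integer using () renaming (+_ to pos)
import Data.Integer as ℤ
import Data.Integer.Properties as ℤ
open import Data.List using (List; []; _∷_; _++_; length; filterᵇ; map; cartesianProduct; tabulate; lookup; allFin)
open import Data.List.Membership.Propositional using (_∈_; _∉_)
open import Data.List.Membership.Propositional.Properties using (∈-filter⁺; ∈-filter⁻; ∈-lookup; ∈-allFin)
open import Data.List.Properties
  using (map-++; map-tabulate; tabulate-lookup; map-∘; filter-notAll; ++-assoc; ++-identityʳ; length-++; length-tabulate)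
import Data.List.Relation.Unary.Any as Any
open import Data.List.Relation.Unary.Any using (here; there)
open import Data.Nat using (ℕ; zero; suc; _+_; _*_; _∸_; _^_; _≤_; _<_; z≤n; s≤s; _≡ᵇ_; _<ᵇ_; _≤ᵇ_; _<?_)
open import Data.Nat.DivMod using (m<n⇒m%n≡m)
open import Data.Nat.ListAction using (sum)
open import Data.Nat.ListAction.Properties using (sum-++)
open import Data.Nat.Properties
open import Data.Nat.Tactic.RingSolver using (solve-∀)
open import Data.Product using (_×_; _,_; proj₁; proj₂; ∃-syntax; uncurry)
open import Data.Rational using (ℚ; toℚᵘ; NonNegative) renaming (_+_ to _+ℚ_; _*_ to _*ℚ_; _/_ to _/ℚ_; _≤_ to _≤ℚ_)
import Data.Rational.Properties as ℚ
import Data.Rational.Unnormalised as ℚᵘ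
import Data.Rational.Unnormalised.Properties as ℚᵘ
open import Data.Unit using (tt)
open import Algebra.Properties.CommutativeMonoid.Sum ℚ.+-0-commutativeMonoid
  using (∑-distrib-+; sum-cong-≗) renaming (sum to sumℚ)
open import Function using (_∘_; Equivalence)
open import Relation.Binary using (tri<; tri≈; tri>)
open import Relation.Binary.PropositionalEquality
open import Relation.Nullary using (does; yes; no; ¬_)
open import Relation.Nullary.Decidable using (T?; dec-true; dec-false)

-- Finite sums of natural numbers

∑ : ∀ {A : Set} → List A → (A → ℕ) → ℕ
∑ L f = sum (map f L)

∑-cong : ∀ {A : Set} (L : List A) {f g : A → ℕ} → (∀ {x} → x ∈ L → f x ≡ g x) → ∑ L f ≡ ∑ L g
∑-cong []      e = refl
∑-cong (x ∷ L) e = cong₂ _+_ (e (here refl)) (∑-cong L (e ∘ there))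

∑-mono : ∀ {A : Set} (L : List A) {f g : A → ℕ} → (∀ x → f x ≤ g x) → ∑ L f ≤ ∑ L g
∑-mono []      e = z≤n
∑-mono (x ∷ L) e = +-mono-≤ (e x) (∑-mono L e)

∑-zero : ∀ {A : Set} (L : List A) → ∑ L (λ _ → 0) ≡ 0
∑-zero []      = refl
∑-zero (x ∷ L) = ∑-zero L

∑-distrib : ∀ {A : Set} (L : List A) (f g : A → ℕ) → ∑ L (λ x → f x + g x) ≡ ∑ L f + ∑ L g
∑-distrib []      f g = refl
∑-distrib (x ∷ L) f g = trans (cong (f x + g x +_) (∑-distrib L f g)) (interchange (f x) (g x) (∑ L f) (∑ L g))
  where
  interchange : ∀ a b c d → a + b + (c + d) ≡ a + c + (b + d)
  interchange = solve-∀

∑-scale : ∀ {A : Set} (L : List A) k (f : A → ℕ) → ∑ L (λ x → k * f x) ≡ k * ∑ L f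
∑-scale []      k f = sym (*-zeroʳ k)
∑-scale (x ∷ L) k f = trans (cong (k * f x +_) (∑-scale L k f)) (sym (*-distribˡ-+ k (f x) (∑ L f)))

∑-swap : ∀ {A B : Set} (K : List A) (L : List B) (f : A → B → ℕ) →
         ∑ K (λ x → ∑ L (f x)) ≡ ∑ L (λ y → ∑ K (λ x → f x y))
∑-swap []      L f = sym (∑-zero L)
∑-swap (x ∷ K) L f = trans (cong (∑ L (f x) +_) (∑-swap K L f)) (sym (∑-distrib L (f x) _))

∑-filter : ∀ {A : Set} (p : A → Bool) (L : List A) (f : A → ℕ) →
           ∑ (filterᵇ p L) f ≡ ∑ L (λ x → bit (p x) * f x)
∑-filter p []      f = refl
∑-filter p (x ∷ L) f with p x
... | true  = cong₂ _+_ (sym (*-identityˡ (f x))) (∑-filter p L f)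
... | false = ∑-filter p L f

length-filterᵇ : ∀ {A : Set} (p : A → Bool) (L : List A) → length (filterᵇ p L) ≡ ∑ L (bit ∘ p)
length-filterᵇ p []      = refl
length-filterᵇ p (x ∷ L) with p x
... | true  = cong suc (length-filterᵇ p L)
... | false = length-filterᵇ p L

∑∑ : ∀ {A : Set} → List A → (A → A → ℕ) → ℕ
∑∑ L f = ∑ L (λ x → ∑ L (f x))

∑∑-cong : ∀ {A : Set} (L : List A) {f g : A → A → ℕ} →
          (∀ {x y} → x ∈ L → y ∈ L → f x y ≡ g x y) → ∑∑ L f ≡ ∑∑ L g
∑∑-cong L e = ∑-cong L λ x∈ → ∑-cong L (e x∈)

∑∑-mono : ∀ {A : Set} (L : List A) {f g : A → A → ℕ} → (∀ x y → f x y ≤ g x y) → ∑∑ L f ≤ ∑∑ L g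
∑∑-mono L e = ∑-mono L λ x → ∑-mono L (e x)

∑∑-distrib : ∀ {A : Set} (L : List A) (f g : A → A → ℕ) →
             ∑∑ L (λ x y → f x y + g x y) ≡ ∑∑ L f + ∑∑ L g
∑∑-distrib L f g = trans (∑-cong L λ {x} _ → ∑-distrib L (f x) (g x)) (∑-distrib L _ _)

∑∑-scale : ∀ {A : Set} (L : List A) k (f : A → A → ℕ) → ∑∑ L (λ x y → k * f x y) ≡ k * ∑∑ L f
∑∑-scale L k f = trans (∑-cong L λ {x} _ → ∑-scale L k (f x)) (∑-scale L k _)

∑∑-filter : ∀ {A : Set} (p : A → Bool) (L : List A) (f : A → A → ℕ) →
            ∑∑ (filterᵇ p L) f ≡ ∑∑ L (λ x y → bit (p x) * (bit (p y) * f x y))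
∑∑-filter p L f = trans (∑-filter p L _)
  (∑-cong L λ {x} _ → trans (cong (bit (p x) *_) (∑-filter p L (f x))) (sym (∑-scale L (bit (p x)) _)))

∑-cartesianProduct : ∀ {A B : Set} (K : List A) (L : List B) (f : A × B → ℕ) →
                     ∑ (cartesianProduct K L) f ≡ ∑ K (λ x → ∑ L (λ y → f (x , y)))
∑-cartesianProduct []      L f = refl
∑-cartesianProduct (x ∷ K) L f = trans (cong sum (map-++ f (map (x ,_) L) (cartesianProduct K L)))
  (trans (sum-++ (map f (map (x ,_) L)) _)
    (cong₂ _+_ (cong sum (sym (map-∘ L))) (∑-cartesianProduct K L f)))

∑-allFin-suc : ∀ n (f : Fin (suc n) → ℕ) → ∑ (allFin (suc n)) f ≡ f zero + ∑ (allFin n) (f ∘ suc)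
∑-allFin-suc n f = cong (λ z → f zero + sum z) (trans (map-tabulate suc f) (sym (map-tabulate (λ i → i) (f ∘ suc))))

∑-indicator : ∀ {n} (u : Fin n) (f : Fin n → ℕ) → ∑ (allFin n) (λ v → bit (does (v Fin.≟ u)) * f v) ≡ f u
∑-indicator {suc n} zero f = trans (∑-allFin-suc n _)
  (trans (cong₂ _+_ (*-identityˡ (f zero)) (∑-zero (allFin n))) (+-identityʳ (f zero)))
∑-indicator {suc n} (suc u) f = trans
  (∑-allFin-suc n (λ v → bit (does (v Fin.≟ suc u)) * f v)) (∑-indicator u (f ∘ suc))

∑∑-indicator : ∀ {n} (u v : Fin n) (f : Fin n → Fin n → ℕ) →
               ∑∑ (allFin n) (λ x y → bit (does (x Fin.≟ u)) * (bit (does (y Fin.≟ v)) * f x y)) ≡ f u v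
∑∑-indicator {n} u v f = trans
  (∑-cong (allFin n) λ {x} _ → trans (∑-scale (allFin n) (bit (does (x Fin.≟ u))) _)
    (cong (bit (does (x Fin.≟ u)) *_) (∑-indicator v (f x))))
  (∑-indicator u (λ x → f x v))

-- Expectations

-- A normalised fraction with a variable numerator does not compute, so the proof passes to
-- unnormalised rationals, where only an integer identity is left.
fromℕ-+ : ∀ a b → fromℕ (a + b) ≡ fromℕ a +ℚ fromℕ b
fromℕ-+ a b = ℚ.toℚᵘ-injective (begin-equality
  toℚᵘ (fromℕ (a + b))                     ≃⟨ ℚ.toℚᵘ-fromℚᵘ (ℚᵘ.mkℚᵘ (pos (a + b)) 0) ⟩
  ℚᵘ.mkℚᵘ (pos (a + b)) 0                    ≃⟨ ℚᵘ.*≡* (cong (ℤ._* pos 1) (sym (cong₂ ℤ._+_ (ℤ.*-identityʳ (pos a)) (ℤ.*-identityʳ (pos b))))) ⟩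
  ℚᵘ.mkℚᵘ (pos a) 0 ℚᵘ.+ ℚᵘ.mkℚᵘ (pos b) 0     ≃⟨ ℚᵘ.+-cong (ℚ.toℚᵘ-fromℚᵘ (ℚᵘ.mkℚᵘ (pos a) 0)) (ℚ.toℚᵘ-fromℚᵘ (ℚᵘ.mkℚᵘ (pos b) 0)) ⟨
  toℚᵘ (fromℕ a) ℚᵘ.+ toℚᵘ (fromℕ b)       ≃⟨ ℚ.toℚᵘ-homo-+ (fromℕ a) (fromℕ b) ⟨
  toℚᵘ (fromℕ a +ℚ fromℕ b)                ∎)
  where open ℚᵘ.≤-Reasoning

fromℕ-mono : ∀ {a b} → a ≤ b → fromℕ a ≤ℚ fromℕ b
fromℕ-mono {a} {b} a≤b = ℚ.toℚᵘ-cancel-≤ (begin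
  toℚᵘ (fromℕ a)       ≃⟨ ℚ.toℚᵘ-fromℚᵘ (ℚᵘ.mkℚᵘ (pos a) 0) ⟩
  ℚᵘ.mkℚᵘ (pos a) 0    ≤⟨ ℚᵘ.*≤* (ℤ.*-monoʳ-≤-nonNeg (pos 1) (ℤ.+≤+ a≤b)) ⟩
  ℚᵘ.mkℚᵘ (pos b) 0    ≃⟨ ℚ.toℚᵘ-fromℚᵘ (ℚᵘ.mkℚᵘ (pos b) 0) ⟨
  toℚᵘ (fromℕ b)       ∎)
  where open ℚᵘ.≤-Reasoning

reciprocal : ∀ k → (pos 1 /ℚ suc k) *ℚ fromℕ (suc k) ≡ fromℕ 1
reciprocal k = ℚ.toℚᵘ-injective (begin-equality
  toℚᵘ ((pos 1 /ℚ suc k) *ℚ fromℕ (suc k))           ≃⟨ ℚ.toℚᵘ-homo-* (pos 1 /ℚ suc k) (fromℕ (suc k)) ⟩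
  toℚᵘ (pos 1 /ℚ suc k) ℚᵘ.* toℚᵘ (fromℕ (suc k))    ≃⟨ ℚᵘ.*-cong (ℚ.toℚᵘ-fromℚᵘ (ℚᵘ.mkℚᵘ (pos 1) k)) (ℚ.toℚᵘ-fromℚᵘ (ℚᵘ.mkℚᵘ (pos (suc k)) 0)) ⟩
  ℚᵘ.mkℚᵘ (pos 1) k ℚᵘ.* ℚᵘ.mkℚᵘ (pos (suc k)) 0         ≃⟨ ℚᵘ.*≡* (cong pos lemma) ⟩
  toℚᵘ (fromℕ 1)                                   ∎)
  where
  open ℚᵘ.≤-Reasoning
  lemma : suc ((k + 0) * 1) ≡ suc (k * 1 + 0)
  lemma = cong suc (trans (cong (_* 1) (+-identityʳ k)) (sym (+-identityʳ (k * 1))))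

1/suc-nonNeg : ∀ k → NonNegative (pos 1 /ℚ suc k)
1/suc-nonNeg k = ℚ.normalize-nonNeg 1 (suc k)

sumℚ-mono : ∀ k {f g : Fin k → ℚ} → (∀ i → f i ≤ℚ g i) → sumℚ f ≤ℚ sumℚ g
sumℚ-mono zero    e = ℚ.≤-refl
sumℚ-mono (suc k) e = ℚ.+-mono-≤ (e zero) (sumℚ-mono k (e ∘ suc))

sumℚ-fromℕ : ∀ k (f : Fin k → ℕ) → sumℚ (fromℕ ∘ f) ≡ fromℕ (sum (tabulate f))
sumℚ-fromℕ zero    f = refl
sumℚ-fromℕ (suc k) f = trans (cong (fromℕ (f zero) +ℚ_) (sumℚ-fromℕ k (f ∘ suc)))
  (sym (fromℕ-+ (f zero) (sum (tabulate (f ∘ suc)))))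

sumℚ-const : ∀ k q → sumℚ {k} (λ _ → q) ≡ fromℕ k *ℚ q
sumℚ-const zero    q = sym (ℚ.*-zeroˡ q)
sumℚ-const (suc k) q = trans (cong₂ _+ℚ_ (sym (ℚ.*-identityˡ q)) (sumℚ-const k q))
  (trans (sym (ℚ.*-distribʳ-+ q (fromℕ 1) (fromℕ k))) (cong (_*ℚ q) (sym (fromℕ-+ 1 k))))

Always-map : ∀ {A : Set} {P Q : A → Set} → (∀ {a} → P a → Q a) → ∀ D → Always P D → Always Q D
Always-map h (ret a)    p = h p
Always-map h (draw k f) p = λ i → Always-map h (f i) (p i)

always-true : ∀ {A : Set} {P : A → Set} → (∀ a → P a) → ∀ D → Always P D
always-true h (ret a)    = h a
always-true h (draw k f) = λ i → always-true h (f i)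

expectation-mono : ∀ {A : Set} {X Y : A → ℚ} (D : Dist A) →
                   Always (λ a → X a ≤ℚ Y a) D → expectation X D ≤ℚ expectation Y D
expectation-mono (ret a)    X≤Y = X≤Y
expectation-mono (draw k f) X≤Y = ℚ.*-monoˡ-≤-nonNeg (pos 1 /ℚ suc k) {{1/suc-nonNeg k}}
  (sumℚ-mono (suc k) λ i → expectation-mono (f i) (X≤Y i))

expectation-cong : ∀ {A : Set} {X Y : A → ℚ} (D : Dist A) →
                   Always (λ a → X a ≡ Y a) D → expectation X D ≡ expectation Y D
expectation-cong (ret a)    X≡Y = X≡Y
expectation-cong (draw k f) X≡Y = cong ((pos 1 /ℚ suc k) *ℚ_)
  (sum-cong-≗ λ i → expectation-cong (f i) (X≡Y i))

expectation-+ : ∀ {A : Set} (X Y : A → ℚ) (D : Dist A) →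
                expectation (λ a → X a +ℚ Y a) D ≡ expectation X D +ℚ expectation Y D
expectation-+ X Y (ret a)    = refl
expectation-+ X Y (draw k f) = trans
  (cong ((pos 1 /ℚ suc k) *ℚ_) (trans (sum-cong-≗ λ i → expectation-+ X Y (f i))
    (∑-distrib-+ (λ i → expectation X (f i)) (λ i → expectation Y (f i)))))
  (ℚ.*-distribˡ-+ (pos 1 /ℚ suc k) _ _)

expectation-const : ∀ {A : Set} q (D : Dist A) → expectation (λ _ → q) D ≡ q
expectation-const q (ret a)    = refl
expectation-const q (draw k f) = begin
  (pos 1 /ℚ suc k) *ℚ sumℚ (λ i → expectation (λ _ → q) (f i))  ≡⟨ cong ((pos 1 /ℚ suc k) *ℚ_) (sum-cong-≗ λ i → expectation-const q (f i)) ⟩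
  (pos 1 /ℚ suc k) *ℚ sumℚ {suc k} (λ _ → q)                    ≡⟨ cong ((pos 1 /ℚ suc k) *ℚ_) (sumℚ-const (suc k) q) ⟩
  (pos 1 /ℚ suc k) *ℚ (fromℕ (suc k) *ℚ q)                      ≡⟨ ℚ.*-assoc (pos 1 /ℚ suc k) (fromℕ (suc k)) q ⟨
  (pos 1 /ℚ suc k) *ℚ fromℕ (suc k) *ℚ q                        ≡⟨ cong (_*ℚ q) (reciprocal k) ⟩
  fromℕ 1 *ℚ q                                                ≡⟨ ℚ.*-identityˡ q ⟩
  q                                                           ∎
  where open ≡-Reasoning

𝔼 : ∀ {A : Set} → (A → ℕ) → Dist A → ℚ
𝔼 X = expectation (fromℕ ∘ X)

𝔼-mono : ∀ {A : Set} {X Y : A → ℕ} (D : Dist A) → Always (λ a → X a ≤ Y a) D → 𝔼 X D ≤ℚ 𝔼 Y D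
𝔼-mono D e = expectation-mono D (Always-map fromℕ-mono D e)

𝔼-cong : ∀ {A : Set} {X Y : A → ℕ} (D : Dist A) → Always (λ a → X a ≡ Y a) D → 𝔼 X D ≡ 𝔼 Y D
𝔼-cong D e = expectation-cong D (Always-map (cong fromℕ) D e)

𝔼-+ : ∀ {A : Set} (X Y : A → ℕ) (D : Dist A) → 𝔼 (λ a → X a + Y a) D ≡ 𝔼 X D +ℚ 𝔼 Y D
𝔼-+ X Y D = trans (expectation-cong D (always-true (λ a → fromℕ-+ (X a) (Y a)) D))
                  (expectation-+ (fromℕ ∘ X) (fromℕ ∘ Y) D)

-- Truth tables

Table : ℕ → Set
Table zero    = Bool
Table (suc k) = Bool → Table k

allTrue : ∀ k → Table k → Bool
allTrue zero    t = t
allTrue (suc k) t = allTrue k (t true) ∧ allTrue k (t false)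

Holds : ∀ k → Table k → Set
Holds zero    t = T t
Holds (suc k) t = ∀ b → Holds k (t b)

-- Proof by reflection: on a closed table `allTrue` evaluates, so a claim about up to six Booleans
-- is certified by `tt` instead of dozens of clauses.
byTable : ∀ k (t : Table k) → T (allTrue k t) → Holds k t
byTable zero    t h = h
byTable (suc k) t h true  with allTrue k (t true) in eq
... | true  = byTable k (t true) (subst T (sym eq) tt)
byTable (suc k) t h false with allTrue k (t true)
... | true  = byTable k (t false) h

T⇒≡ : ∀ {b} → T b → b ≡ true
T⇒≡ = Equivalence.to T-≡

≡⇒T : ∀ {b} → b ≡ true → T b
≡⇒T = Equivalence.from T-≡

≡ᵇ-true : ∀ {a b : ℕ} → a ≡ b → (a ≡ᵇ b) ≡ true
≡ᵇ-true a≡b = T⇒≡ (≡⇒≡ᵇ _ _ a≡b)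

≡ᵇ-false : ∀ {a b : ℕ} → a ≢ b → (a ≡ᵇ b) ≡ false
≡ᵇ-false {a} {b} a≢b with a ≡ᵇ b in eq
... | true  = ⊥-elim (a≢b (≡ᵇ⇒≡ a b (≡⇒T eq)))
... | false = refl

≡ᵇ-sym : ∀ a b → (a ≡ᵇ b) ≡ (b ≡ᵇ a)
≡ᵇ-sym zero    zero    = refl
≡ᵇ-sym zero    (suc b) = refl
≡ᵇ-sym (suc a) zero    = refl
≡ᵇ-sym (suc a) (suc b) = ≡ᵇ-sym a b

-- Applied to the signs of the sides of a triangle, this detects the bad triangles of correlation
-- clustering: two positive sides and one negative.
exactlyTwo : Bool → Bool → Bool → Bool
exactlyTwo true  b c = b xor c
exactlyTwo false b c = b ∧ c

exactlyTwo-swap : ∀ a b c → exactlyTwo a b c ≡ exactlyTwo b a c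
exactlyTwo-swap true  true  true  = refl
exactlyTwo-swap true  true  false = refl
exactlyTwo-swap true  false true  = refl
exactlyTwo-swap true  false false = refl
exactlyTwo-swap false true  true  = refl
exactlyTwo-swap false true  false = refl
exactlyTwo-swap false false true  = refl
exactlyTwo-swap false false false = refl

exactlyTwo-rotate : ∀ a b c → exactlyTwo a b c ≡ exactlyTwo c a b
exactlyTwo-rotate true  true  true  = refl
exactlyTwo-rotate true  true  false = refl
exactlyTwo-rotate true  false true  = refl
exactlyTwo-rotate true  false false = refl
exactlyTwo-rotate false true  true  = refl
exactlyTwo-rotate false true  false = refl
exactlyTwo-rotate false false true  = refl
exactlyTwo-rotate false false false = refl

-- Equality is transitive, so three names never agree in exactly two of their three pairs.
exactlyTwo-≡ᵇ : ∀ a b c → exactlyTwo (a ≡ᵇ b) (a ≡ᵇ c) (b ≡ᵇ c) ≡ false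
exactlyTwo-≡ᵇ a b c with a ≟ b
... | yes refl rewrite ≡ᵇ-true {a} refl with a ≡ᵇ c
...   | true  = refl
...   | false = refl
exactlyTwo-≡ᵇ a b c | no a≢b rewrite ≡ᵇ-false a≢b with a ≟ c
...   | yes refl rewrite ≡ᵇ-false (a≢b ∘ sym) | ≡ᵇ-true {a} refl = refl
...   | no a≢c rewrite ≡ᵇ-false a≢c = refl

-- If one triple has exactly two true entries and the other has not, they differ somewhere. The
-- table expresses the hypothesis as a disjunct, which `implies` then removes.
exactlyTwo-mismatch : ∀ a b c a′ b′ c′ → exactlyTwo a′ b′ c′ ≡ false →
  bit (exactlyTwo a b c) ≤
  bit (exactlyTwo a b c) * bit (c xor c′) + bit (exactlyTwo a b c) * bit (b xor b′) + bit (exactlyTwo a b c) * bit (a xor a′)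
exactlyTwo-mismatch a b c a′ b′ c′ eq = ≤ᵇ⇒≤ _ _ (implies (exactlyTwo a′ b′ c′) _ eq
  (byTable 6 (λ a b c a′ b′ c′ → exactlyTwo a′ b′ c′ ∨
    (bit (exactlyTwo a b c) ≤ᵇ bit (exactlyTwo a b c) * bit (c xor c′)
      + bit (exactlyTwo a b c) * bit (b xor b′) + bit (exactlyTwo a b c) * bit (a xor a′)))
    tt a b c a′ b′ c′))
  where
  implies : ∀ p q → p ≡ false → T (p ∨ q) → T q
  implies false q _ t = t

-- Pivoting

filterᵇ-∈⁺ : ∀ {A : Set} (p : A → Bool) {x : A} {L} → x ∈ L → p x ≡ true → x ∈ filterᵇ p L
filterᵇ-∈⁺ p x∈ px = ∈-filter⁺ (T? ∘ p) x∈ (≡⇒T px)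

filterᵇ-∈⁻ : ∀ {A : Set} (p : A → Bool) {x : A} {L} → x ∈ filterᵇ p L → x ∈ L × p x ≡ true
filterᵇ-∈⁻ p x∈ with ∈-filter⁻ (T? ∘ p) x∈
... | x∈L , px = x∈L , T⇒≡ px

paint : ∀ {n} → ℕ → List (Fin n) → Clustering n → Clustering n
paint c []      C = C
paint c (v ∷ L) C = paint c L (λ u → if does (u Fin.≟ v) then c else C u)

paint-∉ : ∀ {n} c (L : List (Fin n)) C {u} → u ∉ L → paint c L C u ≡ C u
paint-∉ c []      C u∉ = refl
paint-∉ c (v ∷ L) C {u} u∉ rewrite paint-∉ c L (λ u → if does (u Fin.≟ v) then c else C u) (u∉ ∘ there) with u Fin.≟ v
... | yes u≡v = ⊥-elim (u∉ (here u≡v))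
... | no  _   = refl

paint-∈ : ∀ {n} c (L : List (Fin n)) C {u} → u ∈ L → paint c L C u ≡ c
-- The list may repeat `u`, and later paint wins; hence the question whether `u` occurs in the tail
-- comes first.
paint-∈ c (v ∷ L) C {u} u∈ with Any.any? (u Fin.≟_) L
... | yes u∈L = paint-∈ c L _ u∈L
... | no  u∉L rewrite paint-∉ c L (λ u → if does (u Fin.≟ v) then c else C u) u∉L with u∈
...   | there u∈L = ⊥-elim (u∉L u∈L)
...   | here u≡v with u Fin.≟ v
...     | yes _   = refl
...     | no  u≢v = ⊥-elim (u≢v u≡v)

module Pivoting {n} (P : Fin n → Fin n → Bool)
                (P-sym : ∀ u v → P u v ≡ P v u) (P-refl : ∀ u → P u u ≡ true) where

  remaining : Fin n → List (Fin n) → List (Fin n)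
  remaining p = filterᵇ (λ v → not (P p v))

  -- The first argument bounds the number of rounds.
  pivot : ℕ → List (Fin n) → Clustering n → Dist (Clustering n)
  pivot zero    L       C = ret C
  pivot (suc r) []      C = ret C
  pivot (suc r) (x ∷ L) C = draw (length L) λ i →
    let p = lookup (x ∷ L) i in pivot r (remaining p (x ∷ L)) (paint (toℕ p) (x ∷ L) C)

  -- By `P-refl` the pivot itself is removed, so `length L` rounds exhaust the list.
  remaining-shorter : ∀ {p L} → p ∈ L → suc (length (remaining p L)) ≤ length L
  remaining-shorter {p} {L} p∈L = filter-notAll (T? ∘ λ v → not (P p v)) L
    (Any.map (λ { refl t → subst (T ∘ not) (P-refl p) t }) p∈L)

  remaining-∈ : ∀ {p u L} → u ∈ L → P p u ≡ false → u ∈ remaining p L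
  remaining-∈ u∈L eq = filterᵇ-∈⁺ _ u∈L (cong not eq)

  remaining-∉ : ∀ {p u L} → P p u ≡ true → u ∉ remaining p L
  remaining-∉ {p} {u} {L} eq u∈ with trans (sym (cong not eq)) (proj₂ (filterᵇ-∈⁻ _ {L = L} u∈))
  ... | ()

  remaining-⊆ : ∀ {p u L} → u ∈ remaining p L → u ∈ L
  remaining-⊆ {L = L} = proj₁ ∘ filterᵇ-∈⁻ _ {L = L}

  -- What the rounds on `L` may do to a labelling. A round paints the whole list, and later rounds
  -- repaint what remains; since every new name is a node of the list, clusters of different rounds
  -- cannot share one.
  Relabels : List (Fin n) → Clustering n → Clustering n → Set
  Relabels L C D = (∀ {u} → u ∉ L → D u ≡ C u) × (∀ {u} → u ∈ L → ∃[ p ] (p ∈ L × D u ≡ toℕ p))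

  Round : Fin n → List (Fin n) → Clustering n → Clustering n → Set
  Round p L C = Relabels (remaining p L) (paint (toℕ p) L C)

  round-clustered : ∀ {p L C D u} → Round p L C D → u ∈ L → P p u ≡ true → D u ≡ toℕ p
  round-clustered {p} {L} {C} (old , _) u∈L Ppu = trans (old (remaining-∉ {L = L} Ppu)) (paint-∈ (toℕ p) L C u∈L)

  -- The final name of `u` is some node that remains after the round, and the pivot is not such a
  -- node.
  round-remaining : ∀ {p L C D u} → Round p L C D → u ∈ L → P p u ≡ false → D u ≢ toℕ p
  round-remaining {p} {L} (_ , new) u∈L Ppu Du≡p with new (remaining-∈ {L = L} u∈L Ppu)
  ... | q , q∈ , Du≡q with toℕ-injective (trans (sym Du≡p) Du≡q)
  ...   | refl = remaining-∉ {L = L} (P-refl p) q∈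

  relabels : ∀ {p L C D} → p ∈ L → Round p L C D → Relabels L C D
  relabels {p} {L} {C} {D} p∈L R@(old , new) =
    (λ u∉L → trans (old (u∉L ∘ remaining-⊆ {L = L})) (paint-∉ (toℕ p) L C u∉L)) , named
    where
    named : ∀ {u} → u ∈ L → ∃[ q ] (q ∈ L × D u ≡ toℕ q)
    named {u} u∈L with P p u in eq
    ... | true  = p , p∈L , round-clustered R u∈L eq
    ... | false with new (remaining-∈ {L = L} u∈L eq)
    ...   | q , q∈ , Du≡q = q , remaining-⊆ {L = L} q∈ , Du≡q

  pivot-relabels : ∀ r L C → length L ≤ r → Always (Relabels L C) (pivot r L C)
  pivot-relabels zero    []      C L≤r = (λ _ → refl) , λ ()
  pivot-relabels (suc r) []      C L≤r = (λ _ → refl) , λ ()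
  pivot-relabels (suc r) (x ∷ L) C L≤r i = Always-map (relabels (∈-lookup i)) (pivot r _ _)
    (pivot-relabels r _ _ (≤-pred (≤-trans (remaining-shorter (∈-lookup i)) L≤r)))

  Separates : (Fin n → Fin n → Bool) → List (Fin n) → Clustering n → Set
  Separates H L D = ∀ {u v} → u ∈ L → v ∈ L → T (H u v) → D u ≢ D v

  -- Two nodes that leave in the same round are both positive neighbours of its pivot, where `free`
  -- excludes hostility; nodes that leave in different rounds get different names.
  pivot-separates : ∀ (H : Fin n → Fin n → Bool) →
    (∀ p u v → P p u ≡ true → P p v ≡ true → ¬ T (H u v)) →
    ∀ r L C → length L ≤ r → Always (Separates H L) (pivot r L C)
  pivot-separates H free zero    []      C L≤r ()
  pivot-separates H free (suc r) []      C L≤r ()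
  pivot-separates H free (suc r) (x ∷ L) C L≤r i = both (pivot r _ _)
      (pivot-relabels r _ _ rest≤r) (pivot-separates H free r _ _ rest≤r)
    where
    p = lookup (x ∷ L) i
    rest≤r : length (remaining p (x ∷ L)) ≤ r
    rest≤r = ≤-pred (≤-trans (remaining-shorter (∈-lookup i)) L≤r)
    separate : ∀ {D} → Round p (x ∷ L) C D → Separates H (remaining p (x ∷ L)) D → Separates H (x ∷ L) D
    separate R sep {u} {v} u∈ v∈ h Du≡Dv with P p u in equ | P p v in eqv
    ... | true  | true  = free p u v equ eqv h
    ... | true  | false = round-remaining R v∈ eqv (trans (sym Du≡Dv) (round-clustered R u∈ equ))
    ... | false | true  = round-remaining R u∈ equ (trans Du≡Dv (round-clustered R v∈ eqv))
    ... | false | false = sep (remaining-∈ {L = x ∷ L} u∈ equ) (remaining-∈ {L = x ∷ L} v∈ eqv) h Du≡Dv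
    both : ∀ E → Always (Round p (x ∷ L) C) E → Always (Separates H (remaining p (x ∷ L))) E → Always (Separates H (x ∷ L)) E
    both (ret D)    a b = separate a b
    both (draw k f) a b = λ j → both (f j) (a j) (b j)

  mistake : Clustering n → Fin n → Fin n → ℕ
  mistake C u v = bit (P u v xor (C u ≡ᵇ C v))

  -- With pivot `p`, this is the mistake that the round itself makes on `u` and `v`: both join the
  -- cluster though their pair is negative, or just one joins though it is positive. Degenerate
  -- triples contribute 0 because `P` is symmetric and reflexive.
  bad : Fin n → Fin n → Fin n → ℕ
  bad p u v = bit (exactlyTwo (P p u) (P p v) (P u v))

  -- A pair is settled in the round in which its first end leaves the list. If neither end leaves
  -- now, `bad` vanishes and the mistake is deferred unchanged.
  mistake-round : ∀ {p L C D u v} → Round p L C D → u ∈ L → v ∈ L →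
    mistake D u v ≡ bad p u v + bit (not (P p u)) * (bit (not (P p v)) * mistake D u v)
  mistake-round {p} {L} {C} {D} {u} {v} R u∈ v∈ with P p u in equ | P p v in eqv
  ... | true  | true  rewrite ≡ᵇ-true (trans (round-clustered R u∈ equ) (sym (round-clustered R v∈ eqv))) = lemma (P u v)
    where
    lemma : ∀ b → bit (b xor true) ≡ bit (not b) + 0
    lemma true = refl
    lemma false = refl
  ... | true  | false rewrite ≡ᵇ-false (λ Du≡Dv → round-remaining R v∈ eqv (trans (sym Du≡Dv) (round-clustered R u∈ equ))) = lemma (P u v)
    where
    lemma : ∀ b → bit (b xor false) ≡ bit b + 0
    lemma true = refl
    lemma false = refl
  ... | false | true  rewrite ≡ᵇ-false (λ Du≡Dv → round-remaining R u∈ equ (trans Du≡Dv (round-clustered R v∈ eqv))) = lemma (P u v)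
    where
    lemma : ∀ b → bit (b xor false) ≡ bit b + 0
    lemma true = refl
    lemma false = refl
  ... | false | false = sym (trans (*-identityˡ _) (*-identityˡ _))

  -- The weight `g` will be 1 on the one side and three times the mistakes of a fixed clustering on
  -- the other, so that a single decomposition by rounds serves both.
  mistakes : (Fin n → Fin n → ℕ) → List (Fin n) → Clustering n → ℕ
  mistakes g L D = ∑∑ L λ u v → mistake D u v * g u v

  mistakes-round : ∀ g {p L C D} → Round p L C D →
    mistakes g L D ≡ ∑∑ L (λ u v → bad p u v * g u v) + mistakes g (remaining p L) D
  mistakes-round g {p} {L} {C} {D} R = trans
    (∑∑-cong L λ {u} {v} u∈ v∈ → trans (cong (_* g u v) (mistake-round R u∈ v∈)) (rearrange (bad p u v) (bit (not (P p u))) (bit (not (P p v))) (mistake D u v) (g u v)))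
    (trans (∑∑-distrib L _ _) (cong (∑∑ L (λ u v → bad p u v * g u v) +_) (sym (∑∑-filter _ L _))))
    where
    rearrange : ∀ a b c d e → (a + b * (c * d)) * e ≡ a * e + b * (c * (d * e))
    rearrange = solve-∀

  module _ (C₀ : Clustering n) where

    y : Fin n → Fin n → ℕ
    y = mistake C₀

    bad-mistake : ∀ p u v → bad p u v ≤ bad p u v * y u v + bad p u v * y p v + bad p u v * y p u
    bad-mistake p u v = exactlyTwo-mismatch (P p u) (P p v) (P u v) _ _ _ (exactlyTwo-≡ᵇ (C₀ p) (C₀ u) (C₀ v))

    bad-swap : ∀ p u v → bad p u v ≡ bad p v u
    bad-swap p u v rewrite P-sym v u = cong bit (exactlyTwo-swap (P p u) (P p v) (P u v))

    bad-rotate : ∀ p u v → bad p u v ≡ bad u v p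
    bad-rotate p u v rewrite P-sym v p | P-sym u p = cong bit (exactlyTwo-rotate (P p u) (P p v) (P u v))

    -- Badness of a triple is invariant under permutations. Renaming the summation variables
    -- therefore turns each of the three terms of `bad-mistake` into the same sum `S`, whence the
    -- factor 3.
    bad-charge : ∀ L → ∑ L (λ p → ∑∑ L (λ u v → bad p u v * 1)) ≤ ∑ L (λ p → ∑∑ L (λ u v → bad p u v * (3 * y u v)))
    bad-charge L = begin
      ∑ L (λ p → ∑∑ L (λ u v → bad p u v * 1))
        ≤⟨ ∑-mono L (λ p → ∑∑-mono L λ u v → ≤-trans (≤-reflexive (*-identityʳ (bad p u v))) (bad-mistake p u v)) ⟩
      ∑ L (λ p → ∑∑ L (λ u v → bad p u v * y u v + bad p u v * y p v + bad p u v * y p u))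
        ≡⟨ ∑-cong L (λ {p} _ → trans (∑∑-distrib L _ _) (cong (_+ ∑∑ L (λ u v → bad p u v * y p u)) (∑∑-distrib L _ _))) ⟩
      ∑ L (λ p → ∑∑ L (λ u v → bad p u v * y u v) + ∑∑ L (λ u v → bad p u v * y p v) + ∑∑ L (λ u v → bad p u v * y p u))
        ≡⟨ trans (∑-distrib L _ _) (cong (_+ ∑ L (λ p → ∑∑ L (λ u v → bad p u v * y p u))) (∑-distrib L _ _)) ⟩
      S + ∑ L (λ p → ∑∑ L (λ u v → bad p u v * y p v)) + ∑ L (λ p → ∑∑ L (λ u v → bad p u v * y p u))
        ≡⟨ cong₂ (λ a b → S + a + b) opposite-v opposite-u ⟩
      S + S + S
        ≡⟨ three S ⟩
      3 * S
        ≡⟨ trans (∑-cong L λ {p} _ → ∑∑-scale L 3 _) (∑-scale L 3 _) ⟨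
      ∑ L (λ p → ∑∑ L (λ u v → 3 * (bad p u v * y u v)))
        ≡⟨ ∑-cong L (λ {p} _ → ∑∑-cong L λ {u} {v} _ _ → three-out (bad p u v) (y u v)) ⟩
      ∑ L (λ p → ∑∑ L (λ u v → bad p u v * (3 * y u v)))
        ∎
      where
      open ≤-Reasoning
      S = ∑ L (λ p → ∑∑ L (λ u v → bad p u v * y u v))
      three : ∀ s → s + s + s ≡ 3 * s
      three = solve-∀
      three-out : ∀ a b → 3 * (a * b) ≡ a * (3 * b)
      three-out = solve-∀
      opposite-u : ∑ L (λ p → ∑∑ L (λ u v → bad p u v * y p u)) ≡ S
      opposite-u = trans (∑-cong L λ {p} _ → ∑-swap L L _)
        (trans (∑-swap L L _) (∑-cong L λ {v} _ → ∑∑-cong L λ {p} {u} _ _ → cong (_* y p u) (trans (bad-rotate p u v) (bad-rotate u v p))))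
      opposite-v : ∑ L (λ p → ∑∑ L (λ u v → bad p u v * y p v)) ≡ S
      opposite-v = trans (∑-cong L λ {p} _ → ∑-swap L L _)
        (trans (∑-cong L λ {p} _ → ∑∑-cong L λ {v} {u} _ _ → cong (_* y p v) (bad-swap p u v)) opposite-u)

    -- Induction over the rounds. The probability of a pivot is a common factor, so it is enough to
    -- compare sums over all pivots: `bad-charge` handles what this round settles, the induction
    -- hypothesis what remains.
    pivot-mistakes : ∀ r L C → length L ≤ r →
      𝔼 (mistakes (λ _ _ → 1) L) (pivot r L C) ≤ℚ 𝔼 (mistakes (λ u v → 3 * y u v) L) (pivot r L C)
    pivot-mistakes zero    []      C L≤r = ℚ.≤-refl
    pivot-mistakes (suc r) []      C L≤r = ℚ.≤-refl
    pivot-mistakes (suc r) (x ∷ L) C L≤r = ℚ.*-monoˡ-≤-nonNeg (pos 1 /ℚ suc (length L)) {{1/suc-nonNeg (length L)}} (begin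
      sumℚ (λ i → 𝔼 (mistakes (λ _ _ → 1) K) (D i))
        ≡⟨ split (λ _ _ → 1) ⟩
      fromℕ (∑ K (λ p → ∑∑ K (λ u v → bad p u v * 1))) +ℚ sumℚ (λ i → 𝔼 (mistakes (λ _ _ → 1) (rest i)) (D i))
        ≤⟨ ℚ.+-mono-≤ (fromℕ-mono (bad-charge K)) (sumℚ-mono (length K) λ i → pivot-mistakes r (rest i) (paint (toℕ (lookup K i)) K C) (rest≤r i)) ⟩
      fromℕ (∑ K (λ p → ∑∑ K (λ u v → bad p u v * (3 * y u v)))) +ℚ sumℚ (λ i → 𝔼 (mistakes (λ u v → 3 * y u v) (rest i)) (D i))
        ≡⟨ split (λ u v → 3 * y u v) ⟨
      sumℚ (λ i → 𝔼 (mistakes (λ u v → 3 * y u v) K) (D i)) ∎)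
      where
      open ℚ.≤-Reasoning
      K = x ∷ L
      rest : Fin (length K) → List (Fin n)
      rest i = remaining (lookup K i) K
      D : Fin (length K) → Dist (Clustering n)
      D i = pivot r (rest i) (paint (toℕ (lookup K i)) K C)
      rest≤r : ∀ i → length (rest i) ≤ r
      rest≤r i = ≤-pred (≤-trans (remaining-shorter (∈-lookup i)) L≤r)
      -- What is settled now does not depend on the later draws, so it leaves the expectation as a
      -- constant.
      split : ∀ g → sumℚ (λ i → 𝔼 (mistakes g K) (D i)) ≡
                    fromℕ (∑ K (λ p → ∑∑ K (λ u v → bad p u v * g u v))) +ℚ sumℚ (λ i → 𝔼 (mistakes g (rest i)) (D i))
      split g = trans (sum-cong-≗ λ i → trans (𝔼-cong (D i) (Always-map (mistakes-round g {C = C}) (D i) (pivot-relabels r (rest i) (paint (toℕ (lookup K i)) K C) (rest≤r i))))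
                                          (trans (𝔼-+ (λ _ → settled (lookup K i)) (mistakes g (rest i)) (D i))
                                            (cong (_+ℚ 𝔼 (mistakes g (rest i)) (D i)) (expectation-const (fromℕ (settled (lookup K i))) (D i)))))
                  (trans (∑-distrib-+ (λ i → fromℕ (settled (lookup K i))) (λ i → 𝔼 (mistakes g (rest i)) (D i)))
                    (cong (_+ℚ sumℚ (λ i → 𝔼 (mistakes g (rest i)) (D i)))
                      (trans (sumℚ-fromℕ (length K) (settled ∘ lookup K))
                        (cong (fromℕ ∘ sum) (trans (sym (map-tabulate (lookup K) settled)) (cong (map settled) (tabulate-lookup K)))))))
        where
        settled : Fin n → ℕ
        settled p = ∑∑ K (λ u v → bad p u v * g u v)

-- Boolean matrices and the erasure of entries

Matrix : ℕ → Set
Matrix n = Fin n → Fin n → Bool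

∧-true : ∀ a {b} → a ∧ b ≡ true → a ≡ true × b ≡ true
∧-true true eq = refl , eq

not-true : ∀ {a} → not a ≡ true → a ≡ false
not-true {false} _ = refl

<ᵇ-true : ∀ {a b} → a < b → (a <ᵇ b) ≡ true
<ᵇ-true a<b = T⇒≡ (<⇒<ᵇ a<b)

<ᵇ-false : ∀ {a b} → b ≤ a → (a <ᵇ b) ≡ false
<ᵇ-false {a} {b} b≤a with a <ᵇ b in eq
... | true  = ⊥-elim (<⇒≱ (<ᵇ⇒< a b (≡⇒T eq)) b≤a)
... | false = refl

hit : ∀ {n} → Fin n → Fin n → Matrix n
hit u v a b = does (a Fin.≟ u) ∧ does (b Fin.≟ v)

hit-miss : ∀ {n} (u v a b : Fin n) → (a ≡ u → b ≢ v) → hit u v a b ≡ false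
hit-miss u v a b miss with a Fin.≟ u
... | yes a≡u = dec-false (b Fin.≟ v) (miss a≡u)
... | no  _   = refl

-- The flag `x` makes the erasure conditional without a case distinction, mirroring a program that
-- always subtracts the flag from the cell.
erase : ∀ {n} → Bool → Fin n → Fin n → Matrix n → Matrix n
erase x u v M a b = M a b ∧ not (x ∧ hit u v a b)

eraseStar : ∀ {n} → Bool → Fin n → Fin n → Fin n → Matrix n → Matrix n
eraseStar x u v w M = erase x w u (erase x u w (erase x v u (erase x u v M)))

infix 4 _⊑_
_⊑_ : ∀ {n} → Matrix n → Matrix n → Set
M ⊑ N = ∀ a b → M a b ≡ true → N a b ≡ true

erase-⊑ : ∀ {n} x (u v : Fin n) M → erase x u v M ⊑ M
erase-⊑ x u v M a b eq = proj₁ (∧-true (M a b) eq)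

eraseStar-⊑ : ∀ {n} x (u v w : Fin n) M → eraseStar x u v w M ⊑ M
eraseStar-⊑ x u v w M a b = erase-⊑ x u v M a b ∘ erase-⊑ x v u M₁ a b ∘ erase-⊑ x u w M₂ a b ∘ erase-⊑ x w u M₃ a b
  where
  M₁ = erase x u v M
  M₂ = erase x v u M₁
  M₃ = erase x u w M₂

-- Removing conflicts within the budget

module Charging {n} (G : Instance n) where

  open Instance G

  nodes : List (Fin n)
  nodes = allFin n

  -- Matrices of positive pairs also contain the diagonal: a node is then removed together with its
  -- cluster, and no clustering errs on it.
  positive : Matrix n → Matrix n
  positive M u v = M u v ∧ not (H u v)

  conflict : Matrix n → Fin n → Fin n → Fin n → Bool
  conflict M u v w = (positive M u v ∧ positive M u w) ∧ H v w

  positive-⊑ : ∀ {M N} → M ⊑ N → positive M ⊑ positive N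
  positive-⊑ {M} {N} M⊑N a b eq with ∧-true (M a b) eq
  ... | m , h rewrite M⊑N a b m = h

  -- Clearing entries never creates a conflict, because hostility is fixed and positivity only
  -- shrinks. Hence each triple has to be visited only once.
  conflict-⊑ : ∀ {M N} → M ⊑ N → ∀ u v w → conflict N u v w ≡ false → conflict M u v w ≡ false
  conflict-⊑ {M} {N} M⊑N u v w eq with conflict M u v w in eqM
  ... | false = refl
  ... | true with ∧-true (positive M u v ∧ positive M u w) eqM
  ...   | ps , h with ∧-true (positive M u v) ps
  ...     | p , q rewrite positive-⊑ M⊑N u v p | positive-⊑ M⊑N u w q | h with eq
  ...       | ()

  together cut : Clustering n → Fin n → Fin n → ℕ
  together C u v = bit (C u ≡ᵇ C v)
  cut      C u v = bit (not (C u ≡ᵇ C v))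

  weight : (Fin n → Fin n → ℕ) → Matrix n → ℕ
  weight f M = ∑∑ nodes λ u v → bit (positive M u v) * f u v

  weight-cong : ∀ f {M N} → (∀ a b → M a b ≡ N a b) → weight f M ≡ weight f N
  weight-cong f M≗N = ∑∑-cong nodes λ {a} {b} _ _ → cong (λ m → bit (m ∧ not (H a b)) * f a b) (M≗N a b)

  weight-erase : ∀ f M u v → positive M u v ≡ true → weight f M ≡ weight f (erase true u v M) + f u v
  weight-erase f M u v puv = trans
    (∑∑-cong nodes λ {a} {b} _ _ → pointwise a b)
    (trans (∑∑-distrib nodes _ _) (cong (weight f (erase true u v M) +_) (∑∑-indicator u v f)))
    where
    pointwise : ∀ a b → bit (positive M a b) * f a b ≡
      bit (positive (erase true u v M) a b) * f a b + bit (does (a Fin.≟ u)) * (bit (does (b Fin.≟ v)) * f a b)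
    pointwise a b with a Fin.≟ u | b Fin.≟ v
    ... | yes refl | yes refl rewrite puv | proj₁ (∧-true (M a b) puv) = sym (*-identityˡ _)
    ... | yes refl | no  _ rewrite ∧-identityʳ (M a b) = sym (+-identityʳ _)
    ... | no  _    | _     rewrite ∧-identityʳ (M a b) = sym (+-identityʳ _)

  -- Among the pairs cleared from M₀, a feasible clustering cuts at least as many as it keeps
  -- together; both sides are arranged so that no subtraction occurs.
  Budget : Matrix n → Matrix n → Set
  Budget M₀ M = ∀ C → Feasible G C →
    weight (together C) M₀ + weight (cut C) M ≤ weight (cut C) M₀ + weight (together C) M

  record Reduces (M₀ M : Matrix n) : Set where
    field
      symmetric : ∀ u v → M u v ≡ M v u
      diagonal  : ∀ u → M u u ≡ true
      below     : M ⊑ M₀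
      budget    : Budget M₀ M

  open Reduces

  Reduces-resp : ∀ {M₀ M N} → (∀ a b → M a b ≡ N a b) → Reduces M₀ M → Reduces M₀ N
  Reduces-resp e R .symmetric u v = trans (sym (e u v)) (trans (symmetric R u v) (e v u))
  Reduces-resp e R .diagonal u    = trans (sym (e u u)) (diagonal R u)
  Reduces-resp e R .below u v m   = below R u v (trans (e u v) m)
  Reduces-resp e R .budget C F    = subst₂ (λ x y → _ + x ≤ _ + y) (weight-cong (cut C) e) (weight-cong (together C) e) (budget R C F)

  conflict⇒ : ∀ M u v w → conflict M u v w ≡ true → positive M u v ≡ true × positive M u w ≡ true × H v w ≡ true
  conflict⇒ M u v w eq with ∧-true (positive M u v ∧ positive M u w) eq
  ... | ps , h with ∧-true (positive M u v) ps
  ...   | p , q = p , q , h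

  positive⇒¬hostile : ∀ M u v → positive M u v ≡ true → H u v ≡ true → ⊥
  positive⇒¬hostile M u v p h with trans (sym (not-true (proj₂ (∧-true (M u v) p)))) h
  ... | ()

  positive-erase : ∀ x M u v a b → (a ≡ u → b ≢ v) → positive M a b ≡ true → positive (erase x u v M) a b ≡ true
  positive-erase true M u v a b miss p rewrite hit-miss u v a b miss | ∧-identityʳ (M a b) = p
  positive-erase false M u v a b miss p rewrite ∧-identityʳ (M a b) = p

  -- In a conflict the three nodes are distinct, since positive pairs are not hostile and no node is
  -- hostile to itself; so four different ordered cells are cleared. A feasible clustering cannot
  -- keep `u` with both `v` and `w`, hence it cuts at least half of them and the budget survives.
  eraseStar-Reduces : ∀ {M₀ M} u v w → Reduces M₀ M → Reduces M₀ (eraseStar (conflict M u v w) u v w M)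
  eraseStar-Reduces {M₀} {M} u v w R with conflict M u v w in eq
  ... | false = Reduces-resp unchanged R
    where
    unchanged : ∀ a b → M a b ≡ eraseStar false u v w M a b
    unchanged a b = sym (trans (∧-identityʳ _) (trans (∧-identityʳ _) (trans (∧-identityʳ _) (∧-identityʳ _))))
  ... | true with conflict⇒ M u v w eq
  ...   | puv , puw , hvw = record
    { symmetric = λ a b → trans (cong (λ m → (((m ∧ _) ∧ _) ∧ _) ∧ _) (symmetric R a b)) (swapped a b)
    ; diagonal  = diag
    ; below     = λ a b → below R a b ∘ eraseStar-⊑ true u v w M a b
    ; budget    = λ C F → settle _ _ (gains C F) (losses (together C)) (losses (cut C)) (budget R C F)
    }
    where
    M₁ = erase true u v M
    M₂ = erase true v u M₁
    M₃ = erase true u w M₂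
    M₄ = erase true w u M₃

    u≢v : u ≢ v
    u≢v refl = positive⇒¬hostile M u w puw hvw
    u≢w : u ≢ w
    u≢w refl = positive⇒¬hostile M u v puv (trans (H-sym u v) hvw)
    v≢w : v ≢ w
    v≢w refl with trans (sym hvw) (H-irrefl v)
    ... | ()

    flip : ∀ {a b} → positive M a b ≡ true → positive M b a ≡ true
    flip {a} {b} p rewrite symmetric R b a | H-sym b a = p

    -- `weight-erase` needs a cell that is still positive. Distinctness of the nodes shows that the
    -- earlier erasures missed it.
    p₁ : positive M₁ v u ≡ true
    p₁ = positive-erase true M u v v u (λ v≡u _ → u≢v (sym v≡u)) (flip puv)
    p₂ : positive M₂ u w ≡ true
    p₂ = positive-erase true M₁ v u u w (λ u≡v _ → u≢v u≡v)
        (positive-erase true M u v u w (λ _ w≡v → v≢w (sym w≡v)) puw)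
    p₃ : positive M₃ w u ≡ true
    p₃ = positive-erase true M₂ u w w u (λ w≡u _ → u≢w (sym w≡u))
        (positive-erase true M₁ v u w u (λ w≡v _ → v≢w (sym w≡v))
          (positive-erase true M u v w u (λ w≡u _ → u≢w (sym w≡u)) (flip puw)))

    losses : ∀ f → weight f M ≡ weight f M₄ + f w u + f u w + f v u + f u v
    losses f = trans (weight-erase f M u v puv) (cong (_+ f u v)
      (trans (weight-erase f M₁ v u p₁) (cong (_+ f v u)
        (trans (weight-erase f M₂ u w p₂) (cong (_+ f u w) (weight-erase f M₃ w u p₃))))))

    gains : ∀ C → Feasible G C →
      together C w u + together C u w + together C v u + together C u v ≤ cut C w u + cut C u w + cut C v u + cut C u v
    gains C F rewrite ≡ᵇ-sym (C w) (C u) | ≡ᵇ-sym (C v) (C u) with C u ≡ᵇ C w in eqw | C u ≡ᵇ C v in eqv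
    ... | true  | true  = ⊥-elim (F v w (≡⇒T hvw) (trans (sym (≡ᵇ⇒≡ (C u) (C v) (≡⇒T eqv))) (≡ᵇ⇒≡ (C u) (C w) (≡⇒T eqw))))
    ... | true  | false = ≤-refl
    ... | false | true  = ≤-refl
    ... | false | false = z≤n

    settle : ∀ t₀ k₀ {t k t₄ k₄ tw tw′ tv tv′ kw kw′ kv kv′} →
      tw + tw′ + tv + tv′ ≤ kw + kw′ + kv + kv′ →
      t ≡ t₄ + tw + tw′ + tv + tv′ → k ≡ k₄ + kw + kw′ + kv + kv′ →
      t₀ + k ≤ k₀ + t → t₀ + k₄ ≤ k₀ + t₄
    settle t₀ k₀ {t₄ = t₄} {k₄} {tw} {tw′} {tv} {tv′} {kw} {kw′} {kv} {kv′} g refl refl h =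
      +-cancelʳ-≤ (kw + kw′ + kv + kv′) (t₀ + k₄) (k₀ + t₄) (begin
        t₀ + k₄ + (kw + kw′ + kv + kv′)  ≡⟨ regroup t₀ k₄ kw kw′ kv kv′ ⟩
        t₀ + (k₄ + kw + kw′ + kv + kv′)  ≤⟨ h ⟩
        k₀ + (t₄ + tw + tw′ + tv + tv′)  ≡⟨ regroup k₀ t₄ tw tw′ tv tv′ ⟨
        k₀ + t₄ + (tw + tw′ + tv + tv′)  ≤⟨ +-monoʳ-≤ (k₀ + t₄) g ⟩
        k₀ + t₄ + (kw + kw′ + kv + kv′)  ∎)
      where
      open ≤-Reasoning
      regroup : ∀ a b c d e f → a + b + (c + d + e + f) ≡ a + (b + c + d + e + f)
      regroup = solve-∀

    -- The constant matrix freezes the entry, so only the four masks are transposed; transposition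
    -- exchanges them in pairs.
    swapped : ∀ a b → eraseStar true u v w (λ _ _ → M b a) a b ≡ eraseStar true u v w M b a
    swapped a b rewrite ∧-comm (does (b Fin.≟ u)) (does (a Fin.≟ v)) | ∧-comm (does (b Fin.≟ v)) (does (a Fin.≟ u))
                      | ∧-comm (does (b Fin.≟ u)) (does (a Fin.≟ w)) | ∧-comm (does (b Fin.≟ w)) (does (a Fin.≟ u)) =
      reorder (M b a) (not (hit u v a b)) (not (hit v u a b)) (not (hit u w a b)) (not (hit w u a b))
      where
      reorder : ∀ m h₁ h₂ h₃ h₄ → (((m ∧ h₁) ∧ h₂) ∧ h₃) ∧ h₄ ≡ (((m ∧ h₂) ∧ h₁) ∧ h₄) ∧ h₃
      reorder false _     _     _     _     = refl
      reorder true  false false _     _     = refl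
      reorder true  false true  _     _     = refl
      reorder true  true  false _     _     = refl
      reorder true  true  true  false false = refl
      reorder true  true  true  false true  = refl
      reorder true  true  true  true  false = refl
      reorder true  true  true  true  true  = refl

    diag : ∀ a → M₄ a a ≡ true
    diag a rewrite hit-miss u v a a (λ { refl u≡v → u≢v u≡v }) | hit-miss v u a a (λ { refl v≡u → u≢v (sym v≡u) })
                 | hit-miss u w a a (λ { refl u≡w → u≢w u≡w }) | hit-miss w u a a (λ { refl w≡u → u≢w (sym w≡u) })
                 | diagonal R a = refl

  -- The first erasure alone destroys the conflict, and by `conflict-⊑` the others cannot restore
  -- it.
  eraseStar-resolves : ∀ M u v w → conflict (eraseStar (conflict M u v w) u v w M) u v w ≡ false
  eraseStar-resolves M u v w with conflict M u v w in eq
  ... | false = conflict-⊑ (eraseStar-⊑ false u v w M) u v w eq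
  ... | true  = conflict-⊑ ⊑₁ u v w gone
    where
    M₁ = erase true u v M
    M₂ = erase true v u M₁
    M₃ = erase true u w M₂
    ⊑₁ : eraseStar true u v w M ⊑ M₁
    ⊑₁ a b = erase-⊑ true v u M₁ a b ∘ erase-⊑ true u w M₂ a b ∘ erase-⊑ true w u M₃ a b
    gone : conflict M₁ u v w ≡ false
    gone rewrite dec-true (u Fin.≟ u) refl | dec-true (v Fin.≟ v) refl with M u v
    ... | true  = refl
    ... | false = refl

  -- The cost as a sum over ordered pairs

  pairCost : Clustering n → Fin n → Fin n → ℕ
  pairCost C u v = bit (E⁺ u v ∧ not (C u ≡ᵇ C v)) + bit (E⁻ u v ∧ (C u ≡ᵇ C v))

  pairCost-sym : ∀ C u v → pairCost C u v ≡ pairCost C v u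
  pairCost-sym C u v rewrite E⁺-sym u v | ≡ᵇ-sym (C u) (C v) with u Fin.≟ v
  ... | yes refl rewrite dec-true (u Fin.≟ u) refl = refl
  ... | no  u≢v  rewrite dec-false (v Fin.≟ u) (u≢v ∘ sym) = refl

  pairCost-diag : ∀ C u → pairCost C u u ≡ 0
  pairCost-diag C u rewrite E⁺-irrefl u | dec-true (u Fin.≟ u) refl = refl

  _<ᶠ_ : Fin n → Fin n → Bool
  u <ᶠ v = toℕ u <ᵇ toℕ v

  count-pairs : ∀ (p : Fin n × Fin n → Bool) →
    length (filterᵇ p (pairs n)) ≡ ∑∑ nodes (λ u v → bit (u <ᶠ v) * bit (p (u , v)))
  count-pairs p = trans (length-filterᵇ p (pairs n))
    (trans (∑-filter (λ (u , v) → u <ᶠ v) (cartesianProduct nodes nodes) (bit ∘ p))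
      (∑-cartesianProduct nodes nodes _))

  cost≡∑∑ : ∀ C → cost G C ≡ ∑∑ nodes (λ u v → bit (u <ᶠ v) * pairCost C u v)
  cost≡∑∑ C = trans (cong₂ _+_ (count-pairs _) (count-pairs _))
    (trans (sym (∑∑-distrib nodes _ _)) (∑∑-cong nodes λ {u} {v} _ _ → sym (*-distribˡ-+ (bit (u <ᶠ v)) _ _)))

  cost-cong : ∀ {C D} → (∀ u → C u ≡ D u) → cost G C ≡ cost G D
  cost-cong {C} {D} C≗D = trans (cost≡∑∑ C) (trans
    (∑∑-cong nodes λ {u} {v} _ _ → cong₂ (λ c d → bit (u <ᶠ v) * (bit (E⁺ u v ∧ not (c ≡ᵇ d)) + bit (E⁻ u v ∧ (c ≡ᵇ d)))) (C≗D u) (C≗D v))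
    (sym (cost≡∑∑ D)))

  -- `pairCost` is symmetric and vanishes on the diagonal, so ordered pairs count every unordered
  -- pair twice.
  ∑∑-pairCost : ∀ C → ∑∑ nodes (pairCost C) ≡ cost G C + cost G C
  ∑∑-pairCost C = trans (∑∑-cong nodes λ {u} {v} _ _ → ordered u v)
    (trans (∑∑-distrib nodes _ _) (cong₂ _+_ (sym (cost≡∑∑ C)) (trans (∑-swap nodes nodes _) (sym (cost≡∑∑ C)))))
    where
    ordered : ∀ u v → pairCost C u v ≡ bit (u <ᶠ v) * pairCost C u v + bit (v <ᶠ u) * pairCost C v u
    ordered u v with <-cmp (toℕ u) (toℕ v)
    ... | tri< u<v _ _ rewrite <ᵇ-true u<v | <ᵇ-false (<⇒≤ u<v) = sym (trans (+-identityʳ _) (+-identityʳ _))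
    ... | tri> _ _ v<u rewrite <ᵇ-true v<u | <ᵇ-false (<⇒≤ v<u) = trans (pairCost-sym C u v) (sym (+-identityʳ _))
    ... | tri≈ _ eq _ with toℕ-injective eq
    ...   | refl rewrite pairCost-diag C u | <ᵇ-false (≤-refl {toℕ u}) = refl

  -- The approximation guarantee of the pivot clustering

  module Guarantee {M₀ M : Matrix n}
           (M₀-off : ∀ u v → u ≢ v → M₀ u v ≡ E⁺ u v) (M₀-diag : ∀ u → M₀ u u ≡ true)
           (R : Reduces M₀ M) (resolved : ∀ u v w → conflict M u v w ≡ false) where

    P : Matrix n
    P = positive M

    P-sym : ∀ u v → P u v ≡ P v u
    P-sym u v rewrite symmetric R u v | H-sym u v = refl

    P-refl : ∀ u → P u u ≡ true
    P-refl u rewrite diagonal R u | H-irrefl u = refl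

    open Pivoting P P-sym P-refl public

    -- Hostile pairs are cut by both clusterings. On other pairs whose sign is unchanged the budget
    -- terms are equal on both sides, and costs coincide with mistakes. On an erased pair, a factor
    -- k in place of 2 would need 1 + k ≤ 3 if both clusterings cut the pair and 3 ≤ 1 + k if both
    -- keep it together, which forces k = 2.
    pointwise-charge : ∀ {C D} → Feasible G C → Feasible G D → ∀ u v →
      pairCost D u v + mistake D u v * (3 * mistake C u v)
        + 2 * (bit (positive M₀ u v) * cut C u v + bit (P u v) * together C u v)
      ≤ 3 * pairCost C u v + mistake D u v * 1
        + 2 * (bit (positive M₀ u v) * together C u v + bit (P u v) * cut C u v)
    pointwise-charge {C} {D} FC FD u v with u Fin.≟ v
    ... | yes refl rewrite P-refl u | M₀-diag u | H-irrefl u | E⁺-irrefl u | ≡ᵇ-true {C u} refl | ≡ᵇ-true {D u} refl = ≤-refl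
    ... | no u≢v rewrite M₀-off u v u≢v = ≤ᵇ⇒≤ _ _ (premises (E⁺ u v) (H u v) (M u v) (D u ≡ᵇ D v) (C u ≡ᵇ C v) below′ (apart D FD) (apart C FC)
        (byTable 5 (λ e h m d c → (m ∧ not e) ∨ ((h ∧ d) ∨ ((h ∧ c) ∨ claim e h m d c))) tt (E⁺ u v) (H u v) (M u v) (D u ≡ᵇ D v) (C u ≡ᵇ C v)))
      where
      claim : Bool → Bool → Bool → Bool → Bool → Bool
      claim e h m d c =
        (bit (e ∧ not d) + bit (not e ∧ d)) + bit ((m ∧ not h) xor d) * (3 * bit ((m ∧ not h) xor c))
          + 2 * (bit (e ∧ not h) * bit (not c) + bit (m ∧ not h) * bit c)
        ≤ᵇ 3 * (bit (e ∧ not c) + bit (not e ∧ c)) + bit ((m ∧ not h) xor d) * 1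
          + 2 * (bit (e ∧ not h) * bit c + bit (m ∧ not h) * bit (not c))
      premises : ∀ e h m d c → m ∧ not e ≡ false → h ∧ d ≡ false → h ∧ c ≡ false →
        T ((m ∧ not e) ∨ ((h ∧ d) ∨ ((h ∧ c) ∨ claim e h m d c))) → T (claim e h m d c)
      premises e h m d c p q r t rewrite p | q | r = t
      below′ : M u v ∧ not (E⁺ u v) ≡ false
      below′ with M u v in eq
      ... | false = refl
      ... | true rewrite sym (M₀-off u v u≢v) | below R u v eq = refl
      apart : ∀ C → Feasible G C → H u v ∧ (C u ≡ᵇ C v) ≡ false
      apart C F with H u v in eq
      ... | false = refl
      ... | true  = ≡ᵇ-false (F u v (≡⇒T eq))

    -- Sum of `pointwise-charge` over all ordered pairs; there `budget` absorbs the terms with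
    -- factor 2. The costs appear twice because ordered pairs are counted.
    charge : ∀ {C D} → Feasible G C → Feasible G D →
      cost G D + cost G D + mistakes (λ u v → 3 * mistake C u v) nodes D
      ≤ 3 * cost G C + 3 * cost G C + mistakes (λ _ _ → 1) nodes D
    charge {C} {D} FC FD = subst₂ (λ d c → d + mistakes (λ u v → 3 * mistake C u v) nodes D ≤ c + mistakes (λ _ _ → 1) nodes D)
        (∑∑-pairCost D) (trans (cong (3 *_) (∑∑-pairCost C)) (*-distribˡ-+ 3 (cost G C) (cost G C)))
        (absorb errD errC (∑∑ nodes (pairCost D)) (3 * ∑∑ nodes (pairCost C)) (budget R C FC)
          (subst₂ _≤_
            (sums (pairCost D) (λ u v → mistake D u v * (3 * mistake C u v)) (counted M₀ (cut C)) (counted M (together C)))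
            (trans (sums (λ u v → 3 * pairCost C u v) (λ u v → mistake D u v * 1) (counted M₀ (together C)) (counted M (cut C)))
              (cong (λ z → z + errC + 2 * (weight (together C) M₀ + weight (cut C) M)) (∑∑-scale nodes 3 (pairCost C))))
            (∑∑-mono nodes (pointwise-charge FC FD))))
      where
      errD errC : ℕ
      errD = mistakes (λ u v → 3 * mistake C u v) nodes D
      errC = mistakes (λ _ _ → 1) nodes D
      counted : Matrix n → (Fin n → Fin n → ℕ) → Fin n → Fin n → ℕ
      counted N f u v = bit (positive N u v) * f u v
      sums : ∀ (f g h k : Fin n → Fin n → ℕ) →
        ∑∑ nodes (λ u v → f u v + g u v + 2 * (h u v + k u v)) ≡ ∑∑ nodes f + ∑∑ nodes g + 2 * (∑∑ nodes h + ∑∑ nodes k)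
      sums f g h k = trans (∑∑-distrib nodes _ _) (cong₂ _+_ (∑∑-distrib nodes f g)
        (trans (∑∑-scale nodes 2 _) (cong (2 *_) (∑∑-distrib nodes h k))))
      absorb : ∀ a b x y {p q} → q ≤ p → x + a + 2 * p ≤ y + b + 2 * q → x + a ≤ y + b
      absorb a b x y {p} {q} q≤p le = +-cancelʳ-≤ (2 * p) (x + a) (y + b)
        (≤-trans le (+-monoʳ-≤ (y + b) (*-monoʳ-≤ 2 q≤p)))

    -- The initial labelling is arbitrary: all nodes are on the list, so each of them is renamed.
    pivoted : Clustering n → Dist (Clustering n)
    pivoted = pivot n nodes

    pivoted-feasible : ∀ C₀ → Always (Feasible G) (pivoted C₀)
    pivoted-feasible C₀ = Always-map (λ sep u v h → sep (∈-allFin u) (∈-allFin v) h) (pivoted C₀)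
      (pivot-separates H free n nodes C₀ (≤-reflexive (length-tabulate _)))
      where
      free : ∀ p u v → P p u ≡ true → P p v ≡ true → ¬ T (H u v)
      free p u v pu pv h with resolved p u v
      ... | eq rewrite pu | pv | T⇒≡ h with eq
      ...   | ()

    -- Take expectations in `charge`. By `pivot-mistakes` the mistake terms can be replaced by a
    -- common one and cancelled; halving undoes the double count.
    pivoted-cost : ∀ C₀ {C} → Feasible G C → 𝔼 (cost G) (pivoted C₀) ≤ℚ fromℕ (3 * cost G C)
    pivoted-cost C₀ {C} FC = halve (cancel (begin
      (x +ℚ x) +ℚ 𝔼 B D                        ≡⟨ cong (_+ℚ 𝔼 B D) (𝔼-+ (cost G) (cost G) D) ⟨
      𝔼 (λ E → cost G E + cost G E) D +ℚ 𝔼 B D  ≡⟨ 𝔼-+ (λ E → cost G E + cost G E) B D ⟨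
      𝔼 (λ E → cost G E + cost G E + B E) D    ≤⟨ 𝔼-mono D (Always-map (charge FC) D (pivoted-feasible C₀)) ⟩
      𝔼 (λ E → opt + opt + A E) D              ≡⟨ 𝔼-+ (λ _ → opt + opt) A D ⟩
      𝔼 (λ _ → opt + opt) D +ℚ 𝔼 A D           ≡⟨ cong (_+ℚ 𝔼 A D) (expectation-const (fromℕ (opt + opt)) D) ⟩
      fromℕ (opt + opt) +ℚ 𝔼 A D               ≡⟨ cong (_+ℚ 𝔼 A D) (fromℕ-+ opt opt) ⟩
      (fromℕ opt +ℚ fromℕ opt) +ℚ 𝔼 A D        ≤⟨ ℚ.+-monoʳ-≤ (fromℕ opt +ℚ fromℕ opt) (pivot-mistakes C n nodes C₀ (≤-reflexive (length-tabulate _))) ⟩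
      (fromℕ opt +ℚ fromℕ opt) +ℚ 𝔼 B D        ∎))
      where
      open ℚ.≤-Reasoning
      D = pivoted C₀
      x = 𝔼 (cost G) D
      opt = 3 * cost G C
      A = mistakes (λ _ _ → 1) nodes
      B = mistakes (λ u v → 3 * mistake C u v) nodes
      cancel : ∀ {p q r} → p +ℚ r ≤ℚ q +ℚ r → p ≤ℚ q
      cancel {p} {q} {r} le = ℚ.≮⇒≥ λ q<p → ℚ.<-irrefl refl (ℚ.<-≤-trans (ℚ.+-monoˡ-< r q<p) le)
      halve : ∀ {p q} → p +ℚ p ≤ℚ q +ℚ q → p ≤ℚ q
      halve le = ℚ.≮⇒≥ λ q<p → ℚ.<-irrefl refl (ℚ.<-≤-trans (ℚ.+-mono-< q<p q<p) le)

-- Program execution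

-- Equal trees of draws whose outcomes are related leaf by leaf. This carries properties and
-- expectations over from the abstract pivot algorithm to the machine.
data Coupled {A B : Set} (R : A → B → Set) : Dist A → Dist B → Set where
  ret  : ∀ {a b} → R a b → Coupled R (ret a) (ret b)
  draw : ∀ {k f g} → (∀ i → Coupled R (f i) (g i)) → Coupled R (draw k f) (draw k g)

coupled-always : ∀ {A B : Set} {R : A → B → Set} {P : A → Set} {Q : B → Set} →
  (∀ {a b} → R a b → Q b → P a) → ∀ {D E} → Coupled R D E → Always Q E → Always P D
coupled-always h (ret r)  q = h r q
coupled-always h (draw c) q = λ i → coupled-always h (c i) (q i)

coupled-expectation : ∀ {A B : Set} {R : A → B → Set} {X : A → ℚ} {Y : B → ℚ} →
  (∀ {a b} → R a b → X a ≡ Y b) → ∀ {D E} → Coupled R D E → expectation X D ≡ expectation Y E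
coupled-expectation h (ret r)  = h r
coupled-expectation h (draw {k} c) = cong ((pos 1 /ℚ suc k) *ℚ_) (sum-cong-≗ λ i → coupled-expectation h (c i))

updated-other : ∀ {A : Set} (f : ℕ → A) {x y a} → y ≢ x → (f [ x ↦ a ]) y ≡ f y
updated-other f y≢x rewrite ≡ᵇ-false y≢x = refl

updated-same : ∀ {A : Set} (f : ℕ → A) x {a} → (f [ x ↦ a ]) x ≡ a
updated-same f x rewrite ≡ᵇ-true {x} refl = refl

Segment : ∀ {n} → (ℕ → ℕ) → ℕ → List (Fin n) → Set
Segment a i L = ∀ t → a (i + toℕ t) ≡ toℕ (lookup L t)

segment-head : ∀ {n a i v} {L : List (Fin n)} → Segment a i (v ∷ L) → a i ≡ toℕ v
segment-head {a = a} {i} S = trans (cong a (sym (+-identityʳ i))) (S zero)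

segment-tail : ∀ {n a i v} {L : List (Fin n)} → Segment a i (v ∷ L) → Segment a (suc i) L
segment-tail {a = a} {i} S t = trans (cong a (sym (+-suc i (toℕ t)))) (S (suc t))

segment-below : ∀ {n a i x} {k} {L : List (Fin n)} → k < i → Segment a i L → Segment (a [ k ↦ x ]) i L
segment-below {a = a} {i} k<i S t = trans (updated-other a (λ eq → <⇒≢ (<-≤-trans k<i (m≤m+n i (toℕ t))) (sym eq))) (S t)

segment-snoc : ∀ {n a v} (L : List (Fin n)) → Segment a 0 L → Segment (a [ length L ↦ toℕ v ]) 0 (L ++ v ∷ [])
segment-snoc {a = a} L S = extend a L 0 S
  where
  extend : ∀ {n} a {v} (L : List (Fin n)) i → Segment a i L → Segment (a [ i + length L ↦ toℕ v ]) i (L ++ v ∷ [])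
  extend a []      i S zero    = updated-same a (i + 0)
  extend a {v} (x ∷ L) i S zero    = trans (updated-other a (λ eq → m+1+n≢m i (trans (sym eq) (+-identityʳ i)))) (S zero)
  extend a {v} (x ∷ L) i S (suc t) rewrite +-suc i (length L) | +-suc i (toℕ t) = extend a L (suc i) (segment-tail {a = a} {i} {L = L} S) t

segment-prefix : ∀ {n a x} (L : List (Fin n)) → Segment a 0 L → Segment (a [ length L ↦ x ]) 0 L
segment-prefix {a = a} L S t = trans (updated-other a (<⇒≢ (toℕ<n t))) (S t)

segment-tabulate : ∀ {n k} (a : ℕ → ℕ) i (f : Fin n → Fin k) → (∀ j → a (i + toℕ j) ≡ toℕ (f j)) → Segment a i (tabulate f)
segment-tabulate {suc n} a i f h zero    = h zero
segment-tabulate {suc n} a i f h (suc t) = trans (cong a (+-suc i (toℕ t)))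
  (segment-tabulate a (suc i) (f ∘ suc) (λ j → trans (cong a (sym (+-suc i (toℕ j)))) (h (suc j))) t)

module Execution (w : ℕ) where

  -- A deterministic run with an exact step count. Quantifying over the continuation `ks` and the
  -- remaining time `r` is what makes runs compose.
  Runs : ℕ → Program → State → State → Set
  Runs t cs s s′ = ∀ ks r → run w (t + r) (cs ++ ks , s) ≡ run w r (ks , s′)

  runs-++ : ∀ {t t′ cs cs′ s s′ s″} → Runs t cs s s′ → Runs t′ cs′ s′ s″ → Runs (t + t′) (cs ++ cs′) s s″
  runs-++ {t} {t′} {cs} {cs′} {s} R R′ ks r = trans
    (cong₂ (λ t cs → run w t (cs , s)) (+-assoc t t′ r) (++-assoc cs cs′ ks))
    (trans (R (cs′ ++ ks) (t′ + r)) (R′ ks r))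

  enter : ∀ e {body s k} → eval w s e ≡ suc k → ∀ ks r →
          run w (suc r) (while e body ∷ ks , s) ≡ run w r (body ++ while e body ∷ ks , s)
  enter e {s = s} eq ks r with eval w s e
  enter e refl ks r | suc _ = refl

  leave : ∀ e {body s} → eval w s e ≡ 0 → Runs 1 (while e body ∷ []) s s
  leave e {s = s} eq ks r with eval w s e
  leave e refl ks r | zero = refl

  iterate : ∀ e {body s s′ s″ k t t′} → eval w s e ≡ suc k → Runs t body s s′ →
            Runs t′ (while e body ∷ []) s′ s″ → Runs (suc t + t′) (while e body ∷ []) s s″
  iterate e {body} {s} {t = t} {t′} eq R R′ ks r = trans (enter e eq ks (t + t′ + r))
    (trans (cong (λ t → run w t (body ++ while e body ∷ ks , s)) (+-assoc t t′ r))
      (trans (R (while e body ∷ ks) (t′ + r)) (R′ ks r)))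

  random : ∀ {x e s k} → eval w s e ≡ suc k → ∀ ks r →
           run w (suc r) (assignRandom x e ∷ ks , s) ≡ draw k (λ i → run w r (ks , setVar x (toℕ i) s))
  random {e = e} {s} eq ks r with eval w s e
  random refl ks r | suc _ = refl

  halted : ∀ r s → run w r ([] , s) ≡ ret ([] , s)
  halted zero    s = refl
  halted (suc r) s = halted r s

-- Variables: 1, 2, 3 are the nodes u, v, w of a conflict and 4 its truth value; 5 is the number of
-- remaining nodes, 6 the drawn position, 7 the pivot, 8 and 9 the writing and reading positions of a
-- pass, and 10 the node read. The remaining nodes are listed in array 3.

idx : ℕ → ℕ → Expr
idx a b = op add (op mul (var 0) (var a)) (var b)

-- For bits, h < m holds exactly when m is 1 and h is 0, that is, for an entry present in the matrix
-- and not hostile.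
positiveE : ℕ → ℕ → Expr
positiveE a b = op less (read 1 (idx a b)) (read 0 (idx a b))

conflictE : Expr
conflictE = op mul (op mul (positiveE 1 2) (positiveE 1 3)) (read 1 (idx 2 3))

increment : ℕ → Command
increment x = assign x (op add (var x) (lit 1))

-- Subtracting the truth value avoids a branch, so that the running time of a loop body is fixed.
eraseC : ℕ → ℕ → Command
eraseC a b = write 0 (idx a b) (op sub (read 0 (idx a b)) (var 4))

for : ℕ → Program → Command
for x body = while (op less (var x) (var 0)) body

init-body w-body v-body u-body : Program
init-body = write 3 (var 1) (var 1) ∷ write 0 (idx 1 1) (lit 1) ∷ increment 1 ∷ []
w-body = assign 4 conflictE ∷ eraseC 1 2 ∷ eraseC 2 1 ∷ eraseC 1 3 ∷ eraseC 3 1 ∷ increment 3 ∷ []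
v-body = assign 3 (lit 0) ∷ for 3 w-body ∷ increment 2 ∷ []
u-body = assign 2 (lit 0) ∷ for 2 v-body ∷ increment 1 ∷ []

-- A pass names every remaining node after the pivot; only the last name given to a node survives,
-- and that is the pivot whose cluster it joins.
pass : Program
pass = assign 10 (read 3 (var 9)) ∷ write 2 (var 10) (var 7) ∷ write 3 (var 8) (var 10)
     ∷ assign 8 (op add (var 8) (op less (positiveE 7 10) (lit 1))) ∷ increment 9 ∷ []

round prog : Program
round = assignRandom 6 (var 5) ∷ assign 7 (read 3 (var 6)) ∷ assign 8 (lit 0) ∷ assign 9 (lit 0)
      ∷ while (op less (var 9) (var 5)) pass ∷ assign 5 (var 8) ∷ []
prog = for 1 init-body ∷ assign 1 (lit 0) ∷ for 1 u-body ∷ assign 5 (var 0) ∷ while (var 5) round ∷ []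

-- Each iteration pays one unit for its guard; the final 1 is the failing test.
loopTime : ℕ → ℕ → ℕ
loopTime n t = n * suc t + 1

v-time u-time round-time time : ℕ → ℕ
v-time n = 1 + loopTime n 6 + 1
u-time n = 1 + loopTime n (v-time n) + 1
-- The 5 counts the outer guard, the draw and three assignments. Unlike the other times this is only
-- an upper bound, since the list of remaining nodes may be shorter than `n`.
round-time n = 5 + loopTime n 5 + 1
time n = loopTime n 3 + (1 + (loopTime n (u-time n) + (1 + (n * round-time n + 1))))

-- Evaluation and loops on words of sufficient length

module Correctness {n} (G : Instance n) (w : ℕ) (wide : (n + 2) ^ 2 ≤ 2 ^ w) where

  open Instance G
  open Charging G
  open Execution w

  -- Indices of cells lie below n² and counters reach at most n; the additional 1 makes room for
  -- truth values even when n is 0. All of this is below (n + 2)², so reduction to a word changes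
  -- nothing.
  fits : ∀ {a} → a ≤ suc (n * n + n) → word w a ≡ a
  fits {a} a≤ = m<n⇒m%n≡m {n = 2 ^ w} {{m^n≢0 2 w}} (≤-trans (s≤s a≤) (≤-trans (≤-trans (m≤m+n _ (n + n + n + 2)) (≤-reflexive (expand n))) wide))
    where
    expand : ∀ n → suc (suc (n * n + n)) + (n + n + n + 2) ≡ (n + 2) * ((n + 2) * 1)
    expand = solve-∀

  bit≤1 : ∀ b → bit b ≤ 1
  bit≤1 true  = ≤-refl
  bit≤1 false = z≤n

  fits-bit : ∀ b → word w (bit b) ≡ bit b
  fits-bit b = fits (≤-trans (bit≤1 b) (s≤s z≤n))

  fits-suc : ∀ {i} → i < n → word w (i + 1) ≡ suc i
  fits-suc {i} i<n = trans (cong (word w) (+-comm i 1)) (fits (≤-trans i<n (≤-trans (m≤n+m n (n * n)) (n≤1+n _))))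

  cell : Fin n → Fin n → ℕ
  cell u v = n * toℕ u + toℕ v

  cell<n² : ∀ u v → cell u v < n * n
  cell<n² u v = subst (_< n * n) (toℕ-combine u v) (toℕ<n (combine u v))

  cell-≡ᵇ : ∀ u v a b → (cell a b ≡ᵇ cell u v) ≡ hit u v a b
  cell-≡ᵇ u v a b with a Fin.≟ u | b Fin.≟ v
  ... | yes refl | yes refl = ≡ᵇ-true {cell a b} refl
  ... | yes _    | no  b≢v  = ≡ᵇ-false λ eq → b≢v (proj₂ (combine-injective a b u v (toℕ-injective (trans (toℕ-combine a b) (trans eq (sym (toℕ-combine u v)))))))
  ... | no a≢u   | _        = ≡ᵇ-false λ eq → a≢u (proj₁ (combine-injective a b u v (toℕ-injective (trans (toℕ-combine a b) (trans eq (sym (toℕ-combine u v)))))))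

  flatten-cell : ∀ (M : Matrix n) u v → flatten M (cell u v) ≡ bit (M u v)
  flatten-cell M u v with cell u v <? n * n
  ... | no  c≮ = ⊥-elim (c≮ (cell<n² u v))
  ... | yes c< = cong (bit ∘ uncurry M) (trans (cong (remQuot n) index) (remQuot-combine u v))
    where
    index : fromℕ< c< ≡ combine u v
    index = toℕ-injective (trans (toℕ-fromℕ< c<) (sym (toℕ-combine u v)))

  record Stores (s : State) (M : Matrix n) : Set where
    field
      size    : vars s 0 ≡ n
      matrix  : ∀ u v → arrays s 0 (cell u v) ≡ bit (M u v)
      hostile : ∀ u v → arrays s 1 (cell u v) ≡ bit (H u v)

  open Stores

  -- The index `suc x` differs from 0 by computation, so the size kept in variable 0 is untouched;
  -- likewise `suc (suc r)` spares the two matrices in `stores-setCell`.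
  stores-setVar : ∀ {s M x a} → Stores s M → Stores (setVar (suc x) a s) M
  stores-setVar S .size = size S
  stores-setVar S .matrix = matrix S
  stores-setVar S .hostile = hostile S

  stores-setCell : ∀ {s M r i a} → Stores s M → Stores (setCell (suc (suc r)) i a s) M
  stores-setCell S .size = size S
  stores-setCell S .matrix = matrix S
  stores-setCell S .hostile = hostile S

  stores-write : ∀ {s M N i a} u v b → Stores s M → i ≡ cell u v → a ≡ bit b →
    (∀ c d → N c d ≡ (if hit u v c d then b else M c d)) → Stores (setCell 0 i a s) N
  stores-write u v b S refl refl N≗ .size = size S
  stores-write u v b S refl refl N≗ .hostile = hostile S
  stores-write u v b S refl refl N≗ .matrix c d rewrite cell-≡ᵇ u v c d | N≗ c d with hit u v c d
  ... | true  = refl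
  ... | false = matrix S c d

  eval-idx : ∀ {s M a b u v} → Stores s M → vars s a ≡ toℕ u → vars s b ≡ toℕ v → eval w s (idx a b) ≡ cell u v
  eval-idx {u = u} {v} S eqa eqb rewrite size S | eqa | eqb
    | fits {n * toℕ u} (≤-trans (m≤m+n _ (toℕ v)) (≤-trans (<⇒≤ (cell<n² u v)) (≤-trans (m≤m+n _ n) (n≤1+n _))))
    = fits (≤-trans (<⇒≤ (cell<n² u v)) (≤-trans (m≤m+n _ n) (n≤1+n _)))

  eval-positive : ∀ {s M a b u v} → Stores s M → vars s a ≡ toℕ u → vars s b ≡ toℕ v →
                  eval w s (positiveE a b) ≡ bit (positive M u v)
  eval-positive {s} {M} {a} {b} {u} {v} S eqa eqb rewrite eval-idx {a = a} {b} S eqa eqb | matrix S u v | hostile S u v =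
    trans (fits-bit _) (less-bits (H u v) (M u v))
    where
    less-bits : ∀ h m → bit (bit h <ᵇ bit m) ≡ bit (m ∧ not h)
    less-bits false false = refl
    less-bits false true  = refl
    less-bits true  false = refl
    less-bits true  true  = refl

  bit-∧ : ∀ a b → bit a * bit b ≡ bit (a ∧ b)
  bit-∧ true  b = +-identityʳ (bit b)
  bit-∧ false b = refl

  eval-conflict : ∀ {s M u v x} → Stores s M → vars s 1 ≡ toℕ u → vars s 2 ≡ toℕ v → vars s 3 ≡ toℕ x →
                  eval w s conflictE ≡ bit (conflict M u v x)
  eval-conflict {s} {M} {u} {v} {x} S eu ev ex
    rewrite eval-positive {a = 1} {2} S eu ev | eval-positive {a = 1} {3} S eu ex | eval-idx {a = 2} {3} S ev ex | hostile S v x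
          | bit-∧ (positive M u v) (positive M u x) | fits-bit (positive M u v ∧ positive M u x)
          | bit-∧ (positive M u v ∧ positive M u x) (H v x) = fits-bit (conflict M u v x)

  after : Command → State → State
  after (assign x e)    s = setVar x (eval w s e) s
  after (write r e₁ e₂) s = setCell r (eval w s e₁) (eval w s e₂) s
  after _               s = s

  stores-erase : ∀ {s M a b u v x} → Stores s M → vars s a ≡ toℕ u → vars s b ≡ toℕ v → vars s 4 ≡ bit x →
                 Stores (after (eraseC a b) s) (erase x u v M)
  stores-erase {s} {M} {a} {b} {u} {v} {x} S ea eb ex = stores-write u v (M u v ∧ not x) S (eval-idx {a = a} {b} S ea eb) value pointwise
    where
    monus-bits : ∀ m x → bit m ∸ bit x ≡ bit (m ∧ not x)
    monus-bits true  true  = refl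
    monus-bits true  false = refl
    monus-bits false true  = refl
    monus-bits false false = refl
    value : eval w s (op sub (read 0 (idx a b)) (var 4)) ≡ bit (M u v ∧ not x)
    value rewrite eval-idx {a = a} {b} S ea eb | matrix S u v | ex | monus-bits (M u v) x = fits-bit _
    pointwise : ∀ c d → erase x u v M c d ≡ (if hit u v c d then M u v ∧ not x else M c d)
    pointwise c d with c Fin.≟ u | d Fin.≟ v
    ... | yes refl | yes refl = cong (λ z → M u v ∧ not z) (∧-identityʳ x)
    ... | yes _    | no  _    rewrite ∧-zeroʳ x = ∧-identityʳ (M c d)
    ... | no  _    | _        rewrite ∧-zeroʳ x = ∧-identityʳ (M c d)

  guard : ∀ s x y {i m} → vars s x ≡ i → vars s y ≡ m → eval w s (op less (var x) (var y)) ≡ bit (i <ᵇ m)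
  guard s x y refl refl = fits-bit _

  -- Induction on the number `d` of iterations left. As every iteration takes exactly `t` steps, so
  -- does the whole loop take an exact time.
  loop : ∀ (Inv : ℕ → State → Set) x {t body} →
    (∀ {i s} → Inv i s → vars s x ≡ i × vars s 0 ≡ n) →
    (∀ {i s} → i < n → Inv i s → ∃[ s′ ] (Runs t body s s′ × Inv (suc i) s′)) →
    ∀ {s} → Inv 0 s → ∃[ s′ ] (Runs (loopTime n t) (for x body ∷ []) s s′ × Inv n s′)
  loop Inv x {t} {body} regs step = go n 0 refl
    where
    e = op less (var x) (var 0)
    go : ∀ d i {s} → i + d ≡ n → Inv i s → ∃[ s′ ] (Runs (loopTime d t) (for x body ∷ []) s s′ × Inv n s′)
    go zero i {s} eq I rewrite trans (sym (+-identityʳ i)) eq =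
      s , leave e (trans (guard s x 0 (proj₁ (regs I)) (proj₂ (regs I))) (cong bit (<ᵇ-false (≤-refl {n})))) , I
    go (suc d) i {s} eq I with step i<n I
      where
      i<n : i < n
      i<n = subst (i <_) eq (m<m+n i (s≤s z≤n))
    ... | s′ , R , I′ with go d (suc i) (trans (sym (+-suc i d)) eq) I′
    ...   | s″ , R′ , I″ = s″ ,
      subst (λ t → Runs t (for x body ∷ []) s s″) (sym (+-assoc (suc t) (d * suc t) 1))
        (iterate e {t = t} {t′ = loopTime d t} (trans (guard s x 0 (proj₁ (regs I)) (proj₂ (regs I))) (cong bit (<ᵇ-true (subst (i <_) eq (m<m+n i (s≤s z≤n)))))) R R′) , I″

  -- Loop variables are numbered from the outside in, so the loop over variable `x` preserves all
  -- smaller ones. Array 3, the list of nodes, has to survive the sweep as well.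
  Frame : ℕ → State → State → Set
  Frame x s s′ = (∀ y → y < x → vars s′ y ≡ vars s y) × arrays s′ 3 ≡ arrays s 3

  frame-trans : ∀ {x} s s′ s″ → Frame x s s′ → Frame x s′ s″ → Frame x s s″
  frame-trans _ _ _ (f , a) (g , b) = (λ y y<x → trans (g y y<x) (f y y<x)) , trans b a

  frame-≤ : ∀ {x y} s s′ → x ≤ y → Frame y s s′ → Frame x s s′
  frame-≤ _ _ x≤y (f , a) = (λ z z<x → f z (<-≤-trans z<x x≤y)) , a

  frame-setVar : ∀ {x y a} s → x ≤ y → Frame x s (setVar y a s)
  frame-setVar s x≤y = (λ z z<x → updated-other (vars s) (<⇒≢ (<-≤-trans z<x x≤y))) , refl

  -- The sweep over all triples

  module Greedy {M₀ : Matrix n} where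

    Sweeps : ℕ → ℕ → Program → State → Matrix n → (State → Matrix n → Set) → Set
    Sweeps x t cs s M Q = ∃[ s′ ] ∃[ M′ ]
      (Runs t cs s s′ × Stores s′ M′ × Reduces M₀ M′ × M′ ⊑ M × Frame x s s′ × Q s′ M′)

    -- By `anti`, what one iteration establishes survives the erasures of later ones. This is why
    -- one sweep leaves no conflict anywhere.
    sweep-loop : ∀ x t body (Q : Fin n → Matrix n → Set) →
      (∀ {i M N} → M ⊑ N → Q i N → Q i M) → 0 < x → ∀ {s₀ M} →
      (∀ {s N} i → Frame x s₀ s → Stores s N → Reduces M₀ N → vars s x ≡ toℕ i →
        Sweeps x t body s N (λ s′ N′ → vars s′ x ≡ suc (toℕ i) × Q i N′)) →
      Stores s₀ M → Reduces M₀ M → vars s₀ x ≡ 0 →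
      Sweeps x (loopTime n t) (for x body ∷ []) s₀ M (λ _ N → ∀ i → Q i N)
    sweep-loop x t body Q anti 0<x {s₀} {M} step S R x≡0 =
      let s′ , runs , N , S′ , R′ , N⊑M , F′ , _ , done =
            loop Inv x {t} {body} (λ (N , S , R , _ , F , eq , _) → eq , size S)
              advance (M , S , R , (λ _ _ m → m) , ((λ _ _ → refl) , refl) , x≡0 , λ _ ())
      in s′ , N , runs , S′ , R′ , N⊑M , F′ , λ i → done i (toℕ<n i)
      where
      Inv : ℕ → State → Set
      Inv i s = ∃[ N ] (Stores s N × Reduces M₀ N × N ⊑ M × Frame x s₀ s × vars s x ≡ i × (∀ j → toℕ j < i → Q j N))
      advance : ∀ {i s} → i < n → Inv i s → ∃[ s′ ] (Runs t body s s′ × Inv (suc i) s′)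
      advance {i} {s} i<n (N , S , R , N⊑M , F , eq , done)
        with step (fromℕ< i<n) F S R (trans eq (sym (toℕ-fromℕ< i<n)))
      ... | s′ , N′ , runs , S′ , R′ , N′⊑N , F′ , eq′ , q =
        s′ , runs , N′ , S′ , R′ , (λ a b → N⊑M a b ∘ N′⊑N a b) , frame-trans s₀ s s′ F F′ ,
        trans eq′ (cong suc (toℕ-fromℕ< i<n)) , done′
        where
        done′ : ∀ j → toℕ j < suc i → Q j N′
        done′ j j<si with toℕ j ≟ i
        ... | yes refl = subst (λ k → Q k N′) (fromℕ<-toℕ j i<n) q
        ... | no  j≢i  = anti N′⊑N (done j (≤∧≢⇒< (≤-pred j<si) j≢i))

    w-sweep : ∀ {s M} u v x → Stores s M → Reduces M₀ M →
      vars s 1 ≡ toℕ u → vars s 2 ≡ toℕ v → vars s 3 ≡ toℕ x →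
      Sweeps 3 6 w-body s M (λ s′ M′ → vars s′ 3 ≡ suc (toℕ x) × conflict M′ u v x ≡ false)
    w-sweep {s} {M} u v x S R eu ev ex =
      after (increment 3) s₅ , eraseStar c u v x M , (λ _ _ → refl) ,
      stores-setVar S₅ , eraseStar-Reduces u v x R , eraseStar-⊑ c u v x M ,
      ((λ y y<3 → trans (updated-other (vars s₅) (<⇒≢ y<3)) (updated-other (vars s) (<⇒≢ (m<n⇒m<1+n y<3)))) , refl) ,
      trans (cong (λ z → word w (z + word w 1)) ex) (trans (cong (λ z → word w (toℕ x + z)) (fits-bit true)) (fits-suc (toℕ<n x))) ,
      eraseStar-resolves M u v x
      where
      c = conflict M u v x
      s₁ = after (assign 4 conflictE) s
      s₂ = after (eraseC 1 2) s₁
      s₃ = after (eraseC 2 1) s₂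
      s₄ = after (eraseC 1 3) s₃
      s₅ = after (eraseC 3 1) s₄
      ec : vars s₁ 4 ≡ bit c
      ec = eval-conflict S eu ev ex
      S₅ : Stores s₅ (eraseStar c u v x M)
      S₅ = stores-erase {a = 3} {1} {x = c} (stores-erase {a = 1} {3} {x = c} (stores-erase {a = 2} {1} {x = c} (stores-erase {a = 1} {2} {x = c}
             (stores-setVar S) eu ev ec) ev eu ec) eu ex ec) ex eu ec

    v-sweep : ∀ {s M} u v → Stores s M → Reduces M₀ M → vars s 1 ≡ toℕ u → vars s 2 ≡ toℕ v →
      Sweeps 2 (v-time n) v-body s M (λ s′ M′ → vars s′ 2 ≡ suc (toℕ v) × (∀ x → conflict M′ u v x ≡ false))
    v-sweep {s} {M} u v S R eu ev = finish inner
      where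
      s₁ = after (assign 3 (lit 0)) s
      inner : Sweeps 3 (loopTime n 6) (for 3 w-body ∷ []) s₁ M (λ _ N → ∀ x → conflict N u v x ≡ false)
      inner = sweep-loop 3 6 w-body (λ x N → conflict N u v x ≡ false) (λ N⊑ → conflict-⊑ N⊑ u v _) (s≤s z≤n)
        (λ x (f , _) S R ex → w-sweep u v x S R (trans (f 1 (s≤s (s≤s z≤n))) eu) (trans (f 2 ≤-refl) ev) ex)
        (stores-setVar S) R (fits-bit false)
      finish : Sweeps 3 (loopTime n 6) (for 3 w-body ∷ []) s₁ M (λ _ N → ∀ x → conflict N u v x ≡ false) →
        Sweeps 2 (v-time n) v-body s M (λ s′ M′ → vars s′ 2 ≡ suc (toℕ v) × (∀ x → conflict M′ u v x ≡ false))
      finish (s′ , M′ , runs , S′ , R′ , M′⊑M , (f , a) , resolved) =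
        after (increment 2) s′ , M′ ,
        runs-++ {1 + loopTime n 6} {1} {assign 3 (lit 0) ∷ for 3 w-body ∷ []} {increment 2 ∷ []} {s} (λ ks r → runs ks r) (λ _ _ → refl) ,
        stores-setVar S′ , R′ , M′⊑M ,
        frame-trans s s′ (after (increment 2) s′) (frame-≤ s s′ (n≤1+n 2) (frame-trans s s₁ s′ (frame-setVar s ≤-refl) (f , a))) (frame-setVar s′ ≤-refl) ,
        trans (cong (λ z → word w (z + word w 1)) (trans (f 2 ≤-refl) ev)) (trans (cong (λ z → word w (toℕ v + z)) (fits-bit true)) (fits-suc (toℕ<n v))) ,
        resolved

    u-sweep : ∀ {s M} u → Stores s M → Reduces M₀ M → vars s 1 ≡ toℕ u →
      Sweeps 1 (u-time n) u-body s M (λ s′ M′ → vars s′ 1 ≡ suc (toℕ u) × (∀ v x → conflict M′ u v x ≡ false))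
    u-sweep {s} {M} u S R eu = finish inner
      where
      s₁ = after (assign 2 (lit 0)) s
      inner : Sweeps 2 (loopTime n (v-time n)) (for 2 v-body ∷ []) s₁ M (λ _ N → ∀ v x → conflict N u v x ≡ false)
      inner = sweep-loop 2 (v-time n) v-body (λ v N → ∀ x → conflict N u v x ≡ false) (λ N⊑ q x → conflict-⊑ N⊑ u _ x (q x)) (s≤s z≤n)
        (λ v (f , _) S R ev → v-sweep u v S R (trans (f 1 ≤-refl) eu) ev)
        (stores-setVar S) R (fits-bit false)
      finish : Sweeps 2 (loopTime n (v-time n)) (for 2 v-body ∷ []) s₁ M (λ _ N → ∀ v x → conflict N u v x ≡ false) →
        Sweeps 1 (u-time n) u-body s M (λ s′ M′ → vars s′ 1 ≡ suc (toℕ u) × (∀ v x → conflict M′ u v x ≡ false))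
      finish (s′ , M′ , runs , S′ , R′ , M′⊑M , (f , a) , resolved) =
        after (increment 1) s′ , M′ ,
        runs-++ {1 + loopTime n (v-time n)} {1} {assign 2 (lit 0) ∷ for 2 v-body ∷ []} {increment 1 ∷ []} {s} (λ ks r → runs ks r) (λ _ _ → refl) ,
        stores-setVar S′ , R′ , M′⊑M ,
        frame-trans s s′ (after (increment 1) s′) (frame-≤ s s′ (n≤1+n 1) (frame-trans s s₁ s′ (frame-setVar s ≤-refl) (f , a))) (frame-setVar s′ ≤-refl) ,
        trans (cong (λ z → word w (z + word w 1)) (trans (f 1 ≤-refl) eu)) (trans (cong (λ z → word w (toℕ u + z)) (fits-bit true)) (fits-suc (toℕ<n u))) ,
        resolved

    sweep : ∀ {s M} → Stores s M → Reduces M₀ M → vars s 1 ≡ 0 →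
      Sweeps 1 (loopTime n (u-time n)) (for 1 u-body ∷ []) s M (λ _ N → ∀ u v x → conflict N u v x ≡ false)
    sweep S R = sweep-loop 1 (u-time n) u-body (λ u N → ∀ v x → conflict N u v x ≡ false) (λ N⊑ q v x → conflict-⊑ N⊑ _ v x (q v x)) (s≤s z≤n)
      (λ u _ S R eu → u-sweep u S R eu) S R

  -- Setting the diagonal and listing the nodes

  Initialised : Set
  Initialised = ∃[ s ] ∃[ M ] (Runs (loopTime n 3) (for 1 init-body ∷ []) (input G) s × Stores s M ×
    (∀ u v → u ≢ v → M u v ≡ E⁺ u v) × (∀ u → M u u ≡ true) × (∀ (u : Fin n) → arrays s 3 (toℕ u) ≡ toℕ u))

  initialise : Initialised
  initialise =
    let s , runs , M , S , _ , off , diag , named =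
          loop Inv 1 {3} {init-body} (λ (_ , S , eq , _) → eq , size S) advance start
    in s , M , runs , S , off , (λ u → diag u (toℕ<n u)) , λ u → named u (toℕ<n u)
    where
    Inv : ℕ → State → Set
    Inv i s = ∃[ M ] (Stores s M × vars s 1 ≡ i × (∀ u v → u ≢ v → M u v ≡ E⁺ u v) ×
      (∀ u → toℕ u < i → M u u ≡ true) × (∀ (u : Fin n) → toℕ u < i → arrays s 3 (toℕ u) ≡ toℕ u))
    start : Inv 0 (input G)
    start = E⁺ , record { size = refl ; matrix = flatten-cell E⁺ ; hostile = flatten-cell H } , refl , (λ _ _ _ → refl) , (λ _ ()) , λ _ ()
    advance : ∀ {i s} → i < n → Inv i s → ∃[ s′ ] (Runs 3 init-body s s′ × Inv (suc i) s′)
    advance {i} {s} i<n (M , S , eq , off , diag , named) =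
      after (increment 1) s₂ , (λ _ _ → refl) , N ,
      stores-setVar (stores-write i′ i′ true S₁ (eval-idx {a = 1} {1} S₁ eq′ eq′) (fits-bit true) λ _ _ → refl) ,
      trans (cong (λ z → word w (z + word w 1)) eq) (trans (cong (λ z → word w (i + z)) (fits-bit true)) (fits-suc i<n)) ,
      off′ , diag′ , named′
      where
      i′ = fromℕ< i<n
      s₁ = after (write 3 (var 1) (var 1)) s
      s₂ = after (write 0 (idx 1 1) (lit 1)) s₁
      S₁ : Stores s₁ M
      S₁ = stores-setCell {r = 1} {i = vars s 1} {a = vars s 1} S
      eq′ : vars s 1 ≡ toℕ i′
      eq′ = trans eq (sym (toℕ-fromℕ< i<n))
      N : Matrix n
      N a b = if hit i′ i′ a b then true else M a b
      off′ : ∀ u v → u ≢ v → N u v ≡ E⁺ u v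
      off′ u v u≢v rewrite hit-miss i′ i′ u v (λ u≡ v≡ → u≢v (trans u≡ (sym v≡))) = off u v u≢v
      diag′ : ∀ u → toℕ u < suc i → N u u ≡ true
      diag′ u u<si with u Fin.≟ i′
      ... | yes _    = refl
      ... | no  u≢i′ = diag u (≤∧≢⇒< (≤-pred u<si) λ u≡i → u≢i′ (toℕ-injective (trans u≡i (sym (toℕ-fromℕ< i<n)))))
      named′ : ∀ u → toℕ u < suc i → (arrays s 3 [ vars s 1 ↦ vars s 1 ]) (toℕ u) ≡ toℕ u
      named′ u u<si with toℕ u ≟ vars s 1
      ... | yes u≡ = trans (cong (arrays s 3 [ vars s 1 ↦ vars s 1 ]) u≡) (trans (updated-same (arrays s 3) (vars s 1)) (sym u≡))
      ... | no  u≢ = trans (updated-other (arrays s 3) u≢) (named u (≤∧≢⇒< (≤-pred u<si) (λ u≡i → u≢ (trans u≡i (sym eq)))))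

  -- Simulation of the pivot rounds

  module Rounds {M₀ M : Matrix n}
                (M₀-off : ∀ u v → u ≢ v → M₀ u v ≡ E⁺ u v) (M₀-diag : ∀ u → M₀ u u ≡ true)
                (R : Reduces M₀ M) (resolved : ∀ u v x → conflict M u v x ≡ false) where

    open Guarantee M₀-off M₀-diag R resolved

    Outputs : State → Clustering n → Set
    Outputs s C = ∀ u → arrays s 2 (toℕ u) ≡ C u

    outputs-paint : ∀ {s C} v c → Outputs s C → ∀ u → (arrays s 2 [ toℕ v ↦ c ]) (toℕ u) ≡ (if does (u Fin.≟ v) then c else C u)
    outputs-paint {s} v c O u with u Fin.≟ v
    ... | yes refl = updated-same (arrays s 2) (toℕ u)
    ... | no  u≢v  = trans (updated-other (arrays s 2) (u≢v ∘ toℕ-injective)) (O u)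

    -- Invariant of the in-place compaction of array 3: `K` is the prefix already kept, `L` the part
    -- still to be read from position `j` on. By `behind` the writing position never overtakes the
    -- reading position, so no unread node is lost.
    record Compacting (s : State) (m : ℕ) (p : Fin n) (K L : List (Fin n)) (C : Clustering n) : Set where
      field
        j       : ℕ
        stores  : Stores s M
        bound   : vars s 5 ≡ m
        pivotal : vars s 7 ≡ toℕ p
        written : vars s 8 ≡ length K
        current : vars s 9 ≡ j
        behind  : length K ≤ j
        left    : j + length L ≡ m
        kept    : Segment (arrays s 3) 0 K
        pending : Segment (arrays s 3) j L
        outputs : Outputs s C

    open Compacting

    keep-bit : ∀ b → bit (bit b <ᵇ 1) ≡ bit (not b)
    keep-bit true  = refl
    keep-bit false = refl

    -- The node is written behind the kept prefix in either case; only advancing variable 8 retains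
    -- it. Otherwise the next write falls on the same cell.
    pass-step : ∀ {s m p K v L C} → m ≤ n → Compacting s m p K (v ∷ L) C →
      ∃[ s′ ] (Runs 5 pass s s′ ×
        Compacting s′ m p (K ++ remaining p (v ∷ [])) L (λ u → if does (u Fin.≟ v) then toℕ p else C u))
    pass-step {s} {m} {p} {K} {v} {L} {C} m≤n I = s₅ , (λ _ _ → refl) , invariant
      where
      s₁ = after (assign 10 (read 3 (var 9))) s
      s₂ = after (write 2 (var 10) (var 7)) s₁
      s₃ = after (write 3 (var 8) (var 10)) s₂
      s₄ = after (assign 8 (op add (var 8) (op less (positiveE 7 10) (lit 1)))) s₃
      s₅ = after (increment 9) s₄
      S₃ : Stores s₃ M
      S₃ = stores-setCell {r = 1} {i = vars s 8} {a = vars s₁ 10} (stores-setCell {r = 0} {i = vars s₁ 10} {a = vars s 7} (stores-setVar (stores I)))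
      ev : vars s₁ 10 ≡ toℕ v
      ev = trans (cong (arrays s 3) (current I)) (segment-head {a = arrays s 3} {L = L} (pending I))
      j<m : j I < m
      j<m = subst (j I <_) (left I) (m<m+n (j I) (s≤s z≤n))
      moved : ∀ K′ i → Segment (arrays s 3 [ length K ↦ toℕ v ]) i K′ → Segment (arrays s₅ 3) i K′
      moved K′ i = subst₂ (λ k a → Segment (arrays s 3 [ k ↦ a ]) i K′) (sym (written I)) (sym ev)
      keeping : ∀ {b} → P p v ≡ b → vars s₅ 8 ≡ word w (length K + bit (not b))
      keeping refl = cong₂ (λ k b → word w (k + b)) (written I)
        (trans (cong (word w) (trans (cong₂ (λ a b → bit (a <ᵇ b)) (eval-positive {a = 7} {10} S₃ (pivotal I) ev) (fits-bit true)) (keep-bit (P p v)))) (fits-bit _))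
      count : ∀ K′ → vars s₅ 8 ≡ length K′ → length K′ ≤ suc (j I) → Segment (arrays s₅ 3) 0 K′ →
              Compacting s₅ m p K′ L (λ u → if does (u Fin.≟ v) then toℕ p else C u)
      count K′ e≡ e≤ S = record
        { j = suc (j I) ; stores = stores-setVar (stores-setVar S₃) ; bound = bound I ; pivotal = pivotal I
        ; written = e≡ ; current = trans (cong₂ (λ a b → word w (a + b)) (current I) (fits-bit true)) (fits-suc (<-≤-trans j<m m≤n))
        ; behind = e≤ ; left = trans (sym (+-suc (j I) (length L))) (left I)
        ; kept = S
        ; pending = moved L (suc (j I)) (segment-below {a = arrays s 3} {suc (j I)} {k = length K} {L = L} (s≤s (behind I)) (segment-tail {a = arrays s 3} {j I} {L = L} (pending I)))
        ; outputs = λ u → trans (cong₂ (λ i a → (arrays s 2 [ i ↦ a ]) (toℕ u)) ev (pivotal I)) (outputs-paint {s} v (toℕ p) (outputs I) u)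
        }
      K<n : length K < n
      K<n = ≤-<-trans (behind I) (<-≤-trans j<m m≤n)
      invariant : Compacting s₅ m p (K ++ remaining p (v ∷ [])) L (λ u → if does (u Fin.≟ v) then toℕ p else C u)
      invariant with P p v in eq
      ... | true  = subst (λ K → Compacting s₅ m p K L _) (sym (++-identityʳ K))
        (count K (trans (keeping eq) (trans (fits (≤-trans (≤-reflexive (+-identityʳ _)) (≤-trans (<⇒≤ K<n) (≤-trans (m≤n+m n (n * n)) (n≤1+n _))))) (+-identityʳ _)))
          (m≤n⇒m≤1+n (behind I)) (moved K 0 (segment-prefix {a = arrays s 3} K (kept I))))
      ... | false = count (K ++ v ∷ []) (trans (keeping eq) (trans (fits-suc K<n) (sym (trans (length-++ K) (+-comm (length K) 1)))))
          (≤-trans (≤-reflexive (trans (length-++ K) (+-comm (length K) 1))) (s≤s (behind I))) (moved (K ++ v ∷ []) 0 (segment-snoc {a = arrays s 3} K (kept I)))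

    remaining-∷ : ∀ p v L → remaining p (v ∷ []) ++ remaining p L ≡ remaining p (v ∷ L)
    remaining-∷ p v L with P p v
    ... | true  = refl
    ... | false = refl

    pass-loop : ∀ L {s m p K C} → m ≤ n → Compacting s m p K L C →
      ∃[ s′ ] (Runs (loopTime (length L) 5) (while (op less (var 9) (var 5)) pass ∷ []) s s′ ×
        Compacting s′ m p (K ++ remaining p L) [] (paint (toℕ p) L C))
    pass-loop [] {s} {m} {K = K} m≤n I =
      s , leave (op less (var 9) (var 5)) (trans (guard s 9 5 (current I) (bound I)) (cong bit (<ᵇ-false (≤-reflexive (trans (sym (left I)) (+-identityʳ (j I))))))) ,
      subst (λ K → Compacting s m _ K [] _) (sym (++-identityʳ K)) I
    pass-loop (v ∷ L) {s} {m} {p} {K} {C} m≤n I with pass-step m≤n I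
    ... | s′ , runs , I′ with pass-loop L m≤n I′
    ...   | s″ , runs′ , I″ = s″ ,
      subst (λ t → Runs t (while (op less (var 9) (var 5)) pass ∷ []) s s″) (sym (+-assoc 6 (length L * 6) 1))
        (iterate (op less (var 9) (var 5)) {t = 5} {loopTime (length L) 5}
          (trans (guard s 9 5 (current I) (bound I)) (cong bit (<ᵇ-true (subst (j I <_) (left I) (m<m+n (j I) (s≤s z≤n)))))) runs runs′) ,
      subst (λ K → Compacting s″ m p K [] _) (trans (++-assoc K _ _) (cong (K ++_) (remaining-∷ p v L))) I″

    record Alive (s : State) (L : List (Fin n)) (C : Clustering n) : Set where
      field
        stored : Stores s M
        count  : vars s 5 ≡ length L
        names  : Segment (arrays s 3) 0 L
        shown  : Outputs s C

    open Alive

    -- The deterministic part of `round`, to which `Runs` applies; the draw before it is matched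
    -- with the draw of `pivot`.
    afterDraw : Program
    afterDraw = assign 7 (read 3 (var 6)) ∷ assign 8 (lit 0) ∷ assign 9 (lit 0)
              ∷ while (op less (var 9) (var 5)) pass ∷ assign 5 (var 8) ∷ []

    round-runs : ∀ {s L C} → length L ≤ n → Alive s L C → ∀ i →
      ∃[ s′ ] (Runs (3 + loopTime (length L) 5 + 1) afterDraw (setVar 6 (toℕ i) s) s′ ×
        Alive s′ (remaining (lookup L i) L) (paint (toℕ (lookup L i)) L C))
    round-runs {s} {L} {C} L≤n A i = finish (pass-loop L L≤n start)
      where
      p = lookup L i
      s₁ = after (assign 9 (lit 0)) (after (assign 8 (lit 0)) (after (assign 7 (read 3 (var 6))) (setVar 6 (toℕ i) s)))
      start : Compacting s₁ (length L) p [] L C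
      start = record { j = 0 ; stores = stores-setVar (stores-setVar (stores-setVar (stores-setVar (stored A)))) ; bound = count A ; pivotal = names A i
        ; written = fits-bit false ; current = fits-bit false ; behind = z≤n ; left = refl
        ; kept = λ () ; pending = names A ; outputs = shown A }
      finish : _ → _
      finish (s′ , runs , I) = after (assign 5 (var 8)) s′ ,
        runs-++ {3 + loopTime (length L) 5} {1} {assign 7 (read 3 (var 6)) ∷ assign 8 (lit 0) ∷ assign 9 (lit 0) ∷ while (op less (var 9) (var 5)) pass ∷ []}
          {assign 5 (var 8) ∷ []} {setVar 6 (toℕ i) s} (λ ks r → runs ks r) (λ _ _ → refl) ,
        record { stored = stores-setVar (stores I) ; count = written I ; names = kept I ; shown = outputs I }

    Ends : Config → Clustering n → Set
    Ends κ C = Halted κ × (∀ u → output κ u ≡ C u)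

    ending : ∀ t {s C} → Alive s [] C → Coupled Ends (run w (suc t) (while (var 5) round ∷ [] , s)) (ret C)
    ending t {s} A = subst (λ D → Coupled Ends D _) (sym (trans (leave (var 5) {round} (count A) [] t) (halted t s))) (ret (refl , shown A))

    -- Variable 5 holds the length of the list, so the machine and `pivot` draw from the same range
    -- and can be coupled index by index. Any sufficient time `t` will do, because a halted machine
    -- idles.
    rounds : ∀ r t {s L C} → length L ≤ r → length L ≤ n → Alive s L C → r * round-time n + 1 ≤ t →
      Coupled Ends (run w t (while (var 5) round ∷ [] , s)) (pivot r L C)
    rounds r zero {s} {L} {C} L≤r L≤n A t≥ = ⊥-elim (<⇒≱ (m≤n+m 1 (r * round-time n)) t≥)
    rounds zero (suc t) {L = []} L≤r L≤n A t≥ = ending t A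
    rounds (suc r) (suc t) {L = []} L≤r L≤n A t≥ = ending t A
    rounds (suc r) (suc t) {s} {x ∷ L} {C} L≤r L≤n A t≥ = subst (λ D → Coupled Ends D (pivot (suc r) (x ∷ L) C))
        (sym (trans (enter (var 5) {round} (count A) [] t) (trans (cong (λ t → run w t (round ++ while (var 5) round ∷ [] , s)) split)
          (random {6} {var 5} {s} {length L} (count A) (afterDraw ++ while (var 5) round ∷ []) (c + t′)))))
        (draw branch)
      where
      c = 3 + loopTime (length (x ∷ L)) 5 + 1
      t′ = t ∸ suc c
      -- The two units beyond `c` pay for the guard and the draw. Replacing the length of the list
      -- by `n` bounds the round by `round-time n`.
      budgeted : suc (suc c + (r * round-time n + 1)) ≤ suc r * round-time n + 1
      budgeted = ≤-trans (≤-reflexive (sym (+-assoc (suc (suc c)) (r * round-time n) 1)))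
        (+-monoˡ-≤ 1 (+-monoˡ-≤ (r * round-time n) (+-monoˡ-≤ 1 (+-monoʳ-≤ 5 (+-monoˡ-≤ 1 (*-monoˡ-≤ 6 L≤n))))))
      enough : suc c + (r * round-time n + 1) ≤ t
      enough = ≤-pred (≤-trans budgeted t≥)
      split : t ≡ suc (c + t′)
      split = sym (m+[n∸m]≡n (≤-trans (m≤m+n (suc c) _) enough))
      t′≥ : r * round-time n + 1 ≤ t′
      t′≥ = ≤-trans (≤-reflexive (sym (m+n∸m≡n (suc c) _))) (∸-monoˡ-≤ (suc c) enough)
      branch : ∀ i → Coupled Ends
        (run w (c + t′) (afterDraw ++ while (var 5) round ∷ [] , setVar 6 (toℕ i) s))
        (pivot r (remaining (lookup (x ∷ L) i) (x ∷ L)) (paint (toℕ (lookup (x ∷ L) i)) (x ∷ L) C))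
      branch i with round-runs L≤n A i
      ... | s′ , runs , A′ = subst (λ D → Coupled Ends D _) (sym (runs (while (var 5) round ∷ []) t′))
        (rounds r t′ (≤-pred (≤-trans (remaining-shorter (∈-lookup i)) L≤r))
          (≤-trans (<⇒≤ (remaining-shorter (∈-lookup i))) L≤n) A′ t′≥)

  -- Transfer of the guarantee to the program

  Sound : Dist Config → Set
  Sound D = Always (λ κ → Halted κ × Feasible G (output κ)) D
    × (∀ opt → IsMinimumCost G opt → expectation (λ κ → fromℕ (cost G (output κ))) D ≤ℚ fromℕ (3 * opt))

  coupled-sound : ∀ {M₀ M} (off : ∀ u v → u ≢ v → M₀ u v ≡ E⁺ u v) (diag : ∀ u → M₀ u u ≡ true)
    (R : Reduces M₀ M) (resolved : ∀ u v x → conflict M u v x ≡ false) C₀ {D} →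
    Coupled (Rounds.Ends off diag R resolved) D (Guarantee.pivoted off diag R resolved C₀) → Sound D
  coupled-sound off diag R resolved C₀ coupled =
    coupled-always (λ (halts , out) F → halts , λ u v h eq → F u v h (trans (sym (out u)) (trans eq (out v))))
      coupled (pivoted-feasible C₀) ,
    λ { opt ((C , FC , refl) , _) → subst (_≤ℚ fromℕ (3 * opt))
      (sym (coupled-expectation (λ (_ , out) → cong fromℕ (cost-cong out)) coupled)) (pivoted-cost C₀ FC) }
    where open Guarantee off diag R resolved

  module Executed {s₁ M₀}
      (runs₁ : Runs (loopTime n 3) (for 1 init-body ∷ []) (input G) s₁) (S₁ : Stores s₁ M₀)
      (off : ∀ u v → u ≢ v → M₀ u v ≡ E⁺ u v) (diag : ∀ u → M₀ u u ≡ true)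
      (named : ∀ (u : Fin n) → arrays s₁ 3 (toℕ u) ≡ toℕ u) where

    t₁ t₂ : ℕ
    t₂ = n * round-time n + 1
    t₁ = loopTime n (u-time n) + (1 + t₂)

    symmetric₀ : ∀ u v → M₀ u v ≡ M₀ v u
    symmetric₀ u v with u Fin.≟ v
    ... | yes refl = refl
    ... | no  u≢v  = trans (off u v u≢v) (trans (E⁺-sym u v) (sym (off v u (u≢v ∘ sym))))

    reduces₀ : Reduces M₀ M₀
    reduces₀ = record { symmetric = symmetric₀ ; diagonal = diag ; below = λ _ _ m → m
                      ; budget = λ C _ → ≤-reflexive (+-comm (weight (together C) M₀) (weight (cut C) M₀)) }

    open Greedy {M₀}

    swept : Sweeps 1 (loopTime n (u-time n)) (for 1 u-body ∷ []) (after (assign 1 (lit 0)) s₁) M₀ (λ _ N → ∀ u v x → conflict N u v x ≡ false)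
    swept = sweep (stores-setVar S₁) reduces₀ (fits-bit false)

    -- The abstract algorithm is started from whatever array 2 holds after the sweep, so its
    -- contents need not be tracked up to that point.
    conclude : ∀ {s₂ M} → Runs (loopTime n (u-time n)) (for 1 u-body ∷ []) (after (assign 1 (lit 0)) s₁) s₂ →
      Stores s₂ M → arrays s₂ 3 ≡ arrays s₁ 3 →
      ∀ (R : Reduces M₀ M) (resolved : ∀ u v x → conflict M u v x ≡ false) →
      Coupled (Rounds.Ends off diag R resolved) (run w (time n) (prog , input G))
        (Guarantee.pivoted off diag R resolved (output (prog , s₂)))
    conclude {s₂} {M} runs₂ S₂ array3 R resolved =
      subst (λ D → Coupled Ends D (pivoted (output (prog , s₂)))) (sym executed)
        (rounds n t₂ (≤-reflexive (length-tabulate _)) (≤-reflexive (length-tabulate _)) alive ≤-refl)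
      where
      open Rounds off diag R resolved
      open Guarantee off diag R resolved
      executed : run w (time n) (prog , input G) ≡
                 run w t₂ (while (var 5) round ∷ [] , after (assign 5 (var 0)) s₂)
      executed = trans
        (runs₁ (assign 1 (lit 0) ∷ for 1 u-body ∷ assign 5 (var 0) ∷ while (var 5) round ∷ []) (1 + t₁))
        (runs₂ (assign 5 (var 0) ∷ while (var 5) round ∷ []) (1 + t₂))
      alive : Alive (after (assign 5 (var 0)) s₂) nodes (output (prog , s₂))
      alive = record
        { stored = stores-setVar S₂
        ; count  = trans (size S₂) (sym (length-tabulate _))
        ; names  = λ t → trans (cong (λ a → a (toℕ t)) array3) (segment-tabulate (arrays s₁ 3) 0 (λ u → u) named t)
        ; shown  = λ _ → refl }

    sound : Sweeps 1 (loopTime n (u-time n)) (for 1 u-body ∷ []) (after (assign 1 (lit 0)) s₁) M₀ (λ _ N → ∀ u v x → conflict N u v x ≡ false) →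
            Sound (run w (time n) (prog , input G))
    sound (s₂ , M , runs₂ , S₂ , R , _ , (_ , array3) , resolved) =
      coupled-sound off diag R resolved (output (prog , s₂)) (conclude runs₂ S₂ array3 R resolved)

  program-sound : Sound (run w (time n) (prog , input G))
  program-sound = from initialise
    where
    from : Initialised → Sound (run w (time n) (prog , input G))
    from (s₁ , M₀ , runs₁ , S₁ , off , diag , named) = sound swept
      where open Executed runs₁ S₁ off diag named

-- The cubic time bound

time-cubic : time ∈O (λ n → n ^ 3)
-- 37 is the sum of the coefficients 7, 10, 15 and 5; from n = 1 on, lower powers are at most n³.
time-cubic = 37 , 1 , λ n 1≤n → begin
  time n                                          ≡⟨ expand n ⟩
  7 * n ^ 3 + 10 * n ^ 2 + 15 * n ^ 1 + 5 * n ^ 0 ≤⟨ +-mono-≤ (+-mono-≤ (+-monoʳ-≤ (7 * n ^ 3) (bound n 1≤n 10 2 (s≤s (s≤s z≤n)))) (bound n 1≤n 15 1 (s≤s z≤n))) (bound n 1≤n 5 0 z≤n) ⟩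
  7 * n ^ 3 + 10 * n ^ 3 + 15 * n ^ 3 + 5 * n ^ 3 ≡⟨ collect (n ^ 3) ⟩
  37 * n ^ 3                                      ∎
  where
  open ≤-Reasoning
  expand : ∀ n → n * 4 + 1 + (1 + (n * (2 + (n * (2 + (n * 7 + 1) + 1) + 1) + 1) + 1 + (1 + (n * (5 + (n * 6 + 1) + 1) + 1))))
    ≡ 7 * (n * (n * (n * 1))) + 10 * (n * (n * 1)) + 15 * (n * 1) + 5
  expand = solve-∀
  bound : ∀ n → 1 ≤ n → ∀ c k → k ≤ 3 → c * n ^ k ≤ c * n ^ 3
  bound n@(suc _) _ c k k≤3 = *-monoʳ-≤ c (^-monoʳ-≤ n k≤3)
  collect : ∀ m → 7 * m + 10 * m + 15 * m + 5 * m ≡ 37 * m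
  collect = solve-∀

mainTheorem5 : ∃[ prog ] ∃[ time ] ∃[ c ]
    ( (time ∈O (λ n → n ^ 3))
    × (∀ (n : ℕ) (G : Instance n) (w : ℕ) → (n + 2) ^ c ≤ 2 ^ w →
    let D = run w (time n) (prog , input G) in
    Always (λ κ → Halted κ × Feasible G (output κ)) D
    × (∀ (opt : ℕ) → IsMinimumCost G opt →
    expectation (λ κ → fromℕ (cost G (output κ))) D ≤ℚ fromℕ (3 * opt))))
-- The exponent 2 asks only for words that can hold the indices of an n by n matrix, that is, for
-- logarithmic word length.
mainTheorem5 = prog , time , 2 , time-cubic , λ n G w wide → Correctness.program-sound G w wide
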